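{- Let $a\ge 0$ be a real number, and let $G$ be a connected simple graph with $n=|V(G)|$ vertices and minimum degree $\delta=\delta(G)$. Let $k\in(0,n)$ be a real number with $\delta\le\frac{n-k}{2}$. If $$\lambda_{1}(aD(\overline{G})+A(\overline{G}))<(a+1)(\delta+k-1),$$ then $\mu_{f}(G)>\frac{n-k}{2}$.
   Context: Graphs are finite, simple and undirected. $\overline{G}$ is the complement of $G$. For a graph $H$, $A(H)$ is the adjacency matrix, $D(H)$ is the diagonal matrix of vertex degrees, and $\lambda_1(M)$ denotes the largest eigenvalue of a real symmetric matrix $M$. A fractional matching of $G$ is a function $f:E(G)\to[0,1]$ such that for every vertex $v$ the sum of $f(e)$ over all edges $e$ incident with $v$ is at most $1$. The fractional matching number is $\mu_f(G)=\max\{\sum_{e\in E(G)}f(e): f \text{ is a fractional matching of } G\}$. -}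

module Defs where

open import Algebra.Bundles using (CommutativeRing)
open import Data.Bool.Base using (if_then_else_)
open import Data.Fin.Base using (Fin)
import Data.Fin.Base as Fin
import Data.Fin.Properties as Fin
open import Data.List.Base using (List; length; filter; map; allFin; lookup; cartesianProduct)
open import Data.List.Extrema.Nat using (min)
open import Data.Nat.Base using (ℕ)
open import Data.Product.Base using (_×_; _,_; ∃-syntax; Σ-syntax; proj₁; proj₂)
open import Data.Sum.Base using (_⊎_)
open import Data.Vec.Functional using (Vector)
open import Level using (0ℓ; suc)
open import Relation.Binary.Construct.Closure.ReflexiveTransitive using (Star)
open import Relation.Binary.Core using (Rel)
open import Relation.Binary.Definitions using (Symmetric; Irreflexive; Decidable)
open import Relation.Binary.PropositionalEquality using (_≡_; _≢_; ≢-sym)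
open import Relation.Binary.Structures using (IsDecTotalOrder)
open import Relation.Nullary using (¬_; does; ¬?; _×-dec_; _⊎-dec_)
open import Relation.Unary using (Pred; Satisfiable)

-- The classical characterisation of ℝ, unique up to isomorphism:
-- a Dedekind-complete, totally ordered field.  Decidability of the order,
-- automatic under excluded middle, is part of the structure.
-- Only the values of _⁻¹ away from 0# are specified.
record CompleteOrderedField : Set (suc 0ℓ) where
  infix  4 _≤_ _<_
  infix  8 _⁻¹
  infixl 7 _/_
  field
    commutativeRing : CommutativeRing 0ℓ 0ℓ

  open CommutativeRing commutativeRing public hiding (_-_)

  field
    _≤_             : Rel Carrier 0ℓ
    isDecTotalOrder : IsDecTotalOrder _≈_ _≤_
    +-monoʳ-≤       : ∀ x {y z} → y ≤ z → x + y ≤ x + z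
    *-nonNegative   : ∀ {x y} → 0# ≤ x → 0# ≤ y → 0# ≤ x * y
    0≉1             : ¬ 0# ≈ 1#
    _⁻¹             : Carrier → Carrier
    ⁻¹-cong         : ∀ {x y} → x ≈ y → x ⁻¹ ≈ y ⁻¹
    ⁻¹-inverseʳ     : ∀ x → ¬ x ≈ 0# → x * x ⁻¹ ≈ 1#

  UpperBound : Pred Carrier 0ℓ → Pred Carrier 0ℓ
  UpperBound P b = ∀ x → P x → x ≤ b

  field
    complete : (P : Pred Carrier 0ℓ) → Satisfiable P → Satisfiable (UpperBound P) →
               ∃[ s ] (UpperBound P s × (∀ b → UpperBound P b → s ≤ b))

  _<_ : Rel Carrier 0ℓ
  x < y = x ≤ y × ¬ x ≈ y

  infixl 6 _-_
  _-_ : Carrier → Carrier → Carrier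
  x - y = x + - y

  _/_ : Carrier → Carrier → Carrier
  x / y = x * y ⁻¹

  open import Algebra.Properties.CommutativeMonoid.Sum +-commutativeMonoid public
    using (sum; sum-syntax)
  open import Algebra.Definitions.RawMonoid +-rawMonoid using () renaming (_×_ to _•_)

  fromℕ : ℕ → Carrier
  fromℕ m = m • 1#

  IsMaximum : Pred Carrier 0ℓ → Pred Carrier 0ℓ
  IsMaximum P m = P m × UpperBound P m

-- A finite simple graph with vertex set Fin n.
record Graph (n : ℕ) : Set (suc 0ℓ) where
  field
    Adj        : Rel (Fin n) 0ℓ
    adj?       : Decidable Adj
    adj-sym    : Symmetric Adj
    adj-irrefl : Irreflexive _≡_ Adj

open Graph public

module _ {n : ℕ} where

  complement : Graph n → Graph n
  complement G = record
    { Adj        = λ u v → u ≢ v × ¬ Adj G u v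
    ; adj?       = λ u v → ¬? (u Fin.≟ v) ×-dec ¬? (adj? G u v)
    ; adj-sym    = λ (u≢v , ¬uv) → ≢-sym u≢v , λ vu → ¬uv (adj-sym G vu)
    ; adj-irrefl = λ u≡v (u≢v , _) → u≢v u≡v
    }

  Connected : Graph n → Set
  Connected G = ∀ u v → Star (Adj G) u v

  degree : Graph n → Fin n → ℕ
  degree G v = length (filter (adj? G v) (allFin n))

  -- Every degree is less than n, so the default value n of min is only
  -- returned for the graph without vertices.
  minDegree : Graph n → ℕ
  minDegree G = min n (map (degree G) (allFin n))

  -- Each edge is listed once, as its pair of endpoints in increasing order.
  edges : Graph n → List (Fin n × Fin n)
  edges G = filter (λ (u , v) → (u Fin.<? v) ×-dec adj? G u v)
                   (cartesianProduct (allFin n) (allFin n))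

  Edge : Graph n → Set
  Edge G = Fin (length (edges G))

  endpoints : (G : Graph n) → Edge G → Fin n × Fin n
  endpoints G = lookup (edges G)

  Incident : (G : Graph n) → Fin n → Edge G → Set
  Incident G v e = v ≡ proj₁ (endpoints G e) ⊎ v ≡ proj₂ (endpoints G e)

  incident? : (G : Graph n) → Decidable (Incident G)
  incident? G v e = (v Fin.≟ proj₁ (endpoints G e)) ⊎-dec (v Fin.≟ proj₂ (endpoints G e))

module RealGraphTheory (ℝ : CompleteOrderedField) where

  open CompleteOrderedField ℝ

  module _ {n : ℕ} where

    Matrix : Set
    Matrix = Fin n → Fin n → Carrier

    IsEigenvalue : Matrix → Pred Carrier 0ℓ
    IsEigenvalue M μ = Σ[ x ∈ Vector Carrier n ]
      (¬ (∀ i → x i ≈ 0#)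
       × (∀ i → ∑[ j < n ] (M i j * x j) ≈ μ * x i))

    -- Intended for symmetric M, all of whose eigenvalues are real.
    IsLargestEigenvalue : Matrix → Pred Carrier 0ℓ
    IsLargestEigenvalue M = IsMaximum (IsEigenvalue M)

    adjacencyMatrix : Graph n → Matrix
    adjacencyMatrix H i j = if does (adj? H i j) then 1# else 0#

    degreeMatrix : Graph n → Matrix
    degreeMatrix H i j = if does (i Fin.≟ j) then fromℕ (degree H i) else 0#

    aD+A : Carrier → Graph n → Matrix
    aD+A a H i j = a * degreeMatrix H i j + adjacencyMatrix H i j

    IsFractionalMatching : (G : Graph n) → (Edge G → Carrier) → Set
    IsFractionalMatching G f =
        (∀ e → 0# ≤ f e × f e ≤ 1#)
      × (∀ v → sum (λ e → if does (incident? G v e) then f e else 0#) ≤ 1#)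

    IsFractionalMatchingNumber : Graph n → Pred Carrier 0ℓ
    IsFractionalMatchingNumber G =
      IsMaximum (λ w → Σ[ f ∈ (Edge G → Carrier) ] (IsFractionalMatching G f × w ≈ sum f))

{-# OPTIONS --safe #-}

-- By König's theorem the bipartite double cover of G has a matching M and a vertex cover (A , B) with
-- |A| + |B| ≤ |M|.  Averaging M with its transpose gives a fractional matching of weight |M| / 2, and
-- averaging the indicators of A and B gives a fractional vertex cover of the same weight, so μ_f = |M| / 2.
-- If μ_f ≤ (n - k) / 2, then I = V \ (A ∪ B) and S = A ∩ B satisfy |I| = n - |A| - |B| + |S| ≥ k + |S|;
-- I is independent with all its neighbours in S, and nonempty, so |S| ≥ δ.  Hence I is a clique of size
-- at least δ + k in the complement of G, and its indicator has Rayleigh quotient at least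
-- (a + 1)(δ + k - 1).  The supremum of the Rayleigh quotients is an eigenvalue, contradicting the
-- bound on λ₁.
module Submission where

open import Defs
open import Algebra.Bundles using (CommutativeMonoid; CommutativeRing)
import Algebra.Solver.Ring
open import Algebra.Solver.Ring.AlmostCommutativeRing
  using (fromCommutativeRing; _-Raw-AlmostCommutative⟶_)
open import Data.Bool.Base using (Bool; true; false; if_then_else_; _∧_; _∨_; not)
import Data.Bool.Properties as Bool
open import Data.Fin.Base using (Fin; zero; suc)
import Data.Fin.Base as Fin
import Data.Fin.Properties as Fin
open import Data.Integer.Base as ℤ using (ℤ)
import Data.Integer.Properties as ℤ
open import Data.List.Base as List
  using (List; []; _∷_; _++_; length; lookup; filter; allFin; cartesianProduct; tabulate)
open import Data.List.Extrema.Nat using (min≤xs)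
open import Data.List.Membership.Propositional using (_∈_; _∉_)
open import Data.List.Membership.Propositional.Properties
  using (∈-filter⁺; ∈-filter⁻; ∈-cartesianProduct⁺; ∈-allFin; ∈-lookup; ∈-map⁺)
import Data.List.Properties as List
import Data.List.Relation.Unary.All as All
open import Data.List.Relation.Unary.Any using (here; there)
open import Data.Maybe.Base using (Maybe; just; nothing)
open import Data.Nat.Base as ℕ using (ℕ; zero; suc)
import Data.Nat.Properties as ℕ
open import Data.Nat.Solver using (module +-*-Solver)
open import Data.Product.Base using (_×_; _,_; ∃-syntax; proj₁; proj₂)
open import Data.Sum.Base as Sum using (_⊎_; inj₁; inj₂)
open import Data.Vec.Functional using (Vector) renaming (_∷_ to _∷ᵛ_)
open import Function.Base using (_∘_; case_of_; id)
open import Level using (0ℓ)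
open import Relation.Binary.Bundles using (DecTotalOrder)
open import Relation.Binary.Definitions using (tri<; tri≈; tri>)
open import Relation.Binary.PropositionalEquality as ≡ using (_≡_; _≢_)
import Relation.Binary.Reasoning.PartialOrder
import Relation.Binary.Reasoning.Setoid
open import Relation.Nullary using (Dec; ¬_; ¬?; _×-dec_; contradiction; does; no; yes)
open import Relation.Nullary.Decidable using (dec-false; dec-true; decidable-stable)
open import Relation.Unary using (Decidable; Pred)

-- Two maxima have to be shown to be attained over a field given only by axioms: the fractional
-- matching number and the Rayleigh quotient. Neither argument uses compactness. For μ_f, the graph
-- may contain odd cycles, where integral matchings and vertex covers can differ in size. The double
-- cover is bipartite, so there a matching and a cover certify each other, and halving both
-- transfers the equality to G. König's theorem itself is proved by induction on a list of edges,
-- uncrossing two covers, so that no augmenting path has to be represented. For the Rayleigh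
-- quotient, completeness provides the supremum s; the difficulty is to find a nonzero kernel vector
-- of s I - M. Elimination does it: a positive semidefinite matrix is singular or bounds x ∙ x by a
-- multiple of its form, by induction on the size through the Schur complement of the top-left
-- entry. A zero pivot yields a kernel vector at once; a nonzero pivot lifts either alternative from
-- the smaller matrix.

-- Integer polynomial identities in a commutative ring.

module IntegerCoefficients {c ℓ} (R : CommutativeRing c ℓ) where

  open import Data.Integer.Base using (+_; -[1+_])
  open CommutativeRing R
  open import Algebra.Properties.Ring ring
  open import Algebra.Properties.AbelianGroup +-abelianGroup using (⁻¹-∙-comm)
  open import Algebra.Properties.Semiring.Mult.TCOptimised semiring using (×-homo-+; ×1-homo-*; 1+×)
    renaming (_×_ to _•_)
  open import Relation.Binary.Reasoning.Setoid setoid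

  -- With the optimised multiple, `con (+ 1)` and `con (+ 2)` in solver polynomials evaluate by
  -- definition to `1#` and `1# + 1#`, without the trailing `0#` that `fromℕ` produces.
  ⟦_⟧ : ℤ → Carrier
  ⟦ + n ⟧      = n • 1#
  ⟦ -[1+ n ] ⟧ = - (suc n • 1#)

  ⟦⟧-⊖ : ∀ m n → ⟦ m ℤ.⊖ n ⟧ ≈ m • 1# - n • 1#
  ⟦⟧-⊖ m       zero    = trans (sym (+-identityʳ _)) (+-congˡ (sym -0#≈0#))
  ⟦⟧-⊖ zero    (suc n) = sym (+-identityˡ _)
  ⟦⟧-⊖ (suc m) (suc n) = begin
    ⟦ suc m ℤ.⊖ suc n ⟧                  ≡⟨ ≡.cong ⟦_⟧ (ℤ.[1+m]⊖[1+n]≡m⊖n m n) ⟩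
    ⟦ m ℤ.⊖ n ⟧                          ≈⟨ ⟦⟧-⊖ m n ⟩
    m • 1# - n • 1#                      ≈⟨ +-congʳ (+-identityˡ _) ⟨
    0# + m • 1# - n • 1#                 ≈⟨ +-congʳ (+-congʳ (-‿inverseʳ 1#)) ⟨
    1# - 1# + m • 1# - n • 1#            ≈⟨ +-congʳ (+-assoc _ _ _) ⟩
    1# + (- 1# + m • 1#) - n • 1#        ≈⟨ +-congʳ (+-congˡ (+-comm _ _)) ⟩
    1# + (m • 1# - 1#) - n • 1#          ≈⟨ +-congʳ (+-assoc _ _ _) ⟨
    1# + m • 1# - 1# - n • 1#            ≈⟨ +-assoc _ _ _ ⟩
    1# + m • 1# + (- 1# - n • 1#)        ≈⟨ +-congˡ (⁻¹-∙-comm _ _) ⟩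
    1# + m • 1# - (1# + n • 1#)          ≈⟨ +-cong (1+× m 1#) (-‿cong (1+× n 1#)) ⟨
    suc m • 1# - suc n • 1#              ∎

  ⟦⟧-neg : ∀ i → ⟦ ℤ.- i ⟧ ≈ - ⟦ i ⟧
  ⟦⟧-neg (+ zero)  = sym -0#≈0#
  ⟦⟧-neg (+ suc n) = refl
  ⟦⟧-neg -[1+ n ]  = sym (-‿involutive _)

  ⟦⟧-+ : ∀ i j → ⟦ i ℤ.+ j ⟧ ≈ ⟦ i ⟧ + ⟦ j ⟧
  ⟦⟧-+ (+ m)    (+ n)    = ×-homo-+ 1# m n
  ⟦⟧-+ (+ m)    -[1+ n ] = ⟦⟧-⊖ m (suc n)
  ⟦⟧-+ -[1+ m ] (+ n)    = trans (⟦⟧-⊖ n (suc m)) (+-comm _ _)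
  ⟦⟧-+ -[1+ m ] -[1+ n ] = begin
    - (suc (suc (m ℕ.+ n)) • 1#)     ≡⟨ ≡.cong (λ l → - (suc l • 1#)) (ℕ.+-suc m n) ⟨
    - ((suc m ℕ.+ suc n) • 1#)       ≈⟨ -‿cong (×-homo-+ 1# (suc m) (suc n)) ⟩
    - (suc m • 1# + suc n • 1#)      ≈⟨ ⁻¹-∙-comm _ _ ⟨
    - (suc m • 1#) - suc n • 1#      ∎

  ⟦⟧-pos-* : ∀ m n → ⟦ + m ℤ.* + n ⟧ ≈ m • 1# * n • 1#
  ⟦⟧-pos-* m n = trans (reflexive (≡.cong ⟦_⟧ (≡.sym (ℤ.pos-* m n)))) (×1-homo-* m n)

  ⟦⟧-*-pos : ∀ m j → ⟦ + m ℤ.* j ⟧ ≈ m • 1# * ⟦ j ⟧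
  ⟦⟧-*-pos m (+ n)    = ⟦⟧-pos-* m n
  ⟦⟧-*-pos m -[1+ n ] = begin
    ⟦ + m ℤ.* -[1+ n ] ⟧          ≡⟨ ≡.cong ⟦_⟧ (ℤ.neg-distribʳ-* (+ m) (+ suc n)) ⟨
    ⟦ ℤ.- (+ m ℤ.* + suc n) ⟧     ≈⟨ ⟦⟧-neg (+ m ℤ.* + suc n) ⟩
    - ⟦ + m ℤ.* + suc n ⟧         ≈⟨ -‿cong (⟦⟧-pos-* m (suc n)) ⟩
    - (m • 1# * suc n • 1#)       ≈⟨ -‿distribʳ-* _ _ ⟩
    m • 1# * - (suc n • 1#)       ∎

  ⟦⟧-* : ∀ i j → ⟦ i ℤ.* j ⟧ ≈ ⟦ i ⟧ * ⟦ j ⟧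
  ⟦⟧-* (+ m)    j = ⟦⟧-*-pos m j
  ⟦⟧-* -[1+ m ] j = begin
    ⟦ -[1+ m ] ℤ.* j ⟧            ≡⟨ ≡.cong ⟦_⟧ (ℤ.neg-distribˡ-* (+ suc m) j) ⟨
    ⟦ ℤ.- (+ suc m ℤ.* j) ⟧       ≈⟨ ⟦⟧-neg (+ suc m ℤ.* j) ⟩
    - ⟦ + suc m ℤ.* j ⟧           ≈⟨ -‿cong (⟦⟧-*-pos (suc m) j) ⟩
    - (suc m • 1# * ⟦ j ⟧)        ≈⟨ -‿distribˡ-* _ _ ⟩
    - (suc m • 1#) * ⟦ j ⟧        ∎

  ℤ⟶R : ℤ.+-*-rawRing -Raw-AlmostCommutative⟶ fromCommutativeRing R
  ℤ⟶R = record
    { ⟦_⟧    = ⟦_⟧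
    ; +-homo = ⟦⟧-+
    ; *-homo = ⟦⟧-*
    ; -‿homo = ⟦⟧-neg
    ; 0-homo = refl
    ; 1-homo = refl
    }

  ⟦⟧-≟ : ∀ i j → Maybe (⟦ i ⟧ ≈ ⟦ j ⟧)
  ⟦⟧-≟ i j with i ℤ.≟ j
  ... | yes i≡j = just (reflexive (≡.cong ⟦_⟧ i≡j))
  ... | no  _   = nothing

  module Solver = Algebra.Solver.Ring ℤ.+-*-rawRing (fromCommutativeRing R) ℤ⟶R ⟦⟧-≟

-- Finite sums in a commutative monoid, for natural numbers and field elements alike.

module FiniteSums {c ℓ} (M : CommutativeMonoid c ℓ) where
  open CommutativeMonoid M
    renaming ( _∙_ to _+_; ε to 0#; ∙-congˡ to +-congˡ; assoc to +-assoc
             ; identityˡ to +-identityˡ; identityʳ to +-identityʳ)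
  open import Algebra.Properties.CommutativeMonoid.Sum M

  sum-δ : ∀ {n} (i : Fin n) (f : Fin n → Carrier) →
          sum (λ j → if does (i Fin.≟ j) then f j else 0#) ≈ f i
  sum-δ {suc n} zero    f = trans (+-congˡ (sum-replicate-zero n)) (+-identityʳ _)
  sum-δ         (suc i) f = trans (+-identityˡ _) (sum-δ i (f ∘ suc))

  -- The two orientations of the equality test are not definitionally equal, and both occur: `i ≟ j`
  -- in the rows of matrices, `j ≟ i` in inserted points.
  sum-δ′ : ∀ {n} (i : Fin n) (f : Fin n → Carrier) →
           sum (λ j → if does (j Fin.≟ i) then f j else 0#) ≈ f i
  sum-δ′ {suc n} zero    f = trans (+-congˡ (sum-replicate-zero n)) (+-identityʳ _)
  sum-δ′         (suc i) f = trans (+-identityˡ _) (sum-δ′ i (f ∘ suc))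

  module _ {a} {A : Set a} where

    sum-lookup-++ : (φ : A → Carrier) → ∀ xs ys →
      sum (φ ∘ lookup (xs ++ ys)) ≈ sum (φ ∘ lookup xs) + sum (φ ∘ lookup ys)
    sum-lookup-++ φ []       ys = sym (+-identityˡ _)
    sum-lookup-++ φ (x ∷ xs) ys = trans (+-congˡ (sum-lookup-++ φ xs ys)) (sym (+-assoc _ _ _))

    sum-lookup-filter : ∀ {p} {P : Pred A p} (P? : Decidable P) (φ : A → Carrier) → ∀ xs →
      sum (φ ∘ lookup (filter P? xs)) ≈ sum ((λ x → if does (P? x) then φ x else 0#) ∘ lookup xs)
    sum-lookup-filter P? φ []       = refl
    sum-lookup-filter P? φ (x ∷ xs) with does (P? x)
    ... | true  = +-congˡ (sum-lookup-filter P? φ xs)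
    ... | false = trans (sum-lookup-filter P? φ xs) (sym (+-identityˡ _))

    sum-lookup-map : ∀ {b} {B : Set b} (f : B → A) (φ : A → Carrier) → ∀ xs →
      sum (φ ∘ lookup (List.map f xs)) ≈ sum (φ ∘ f ∘ lookup xs)
    sum-lookup-map f φ []       = refl
    sum-lookup-map f φ (x ∷ xs) = +-congˡ (sum-lookup-map f φ xs)

    sum-lookup-tabulate : ∀ {n} (f : Fin n → A) (φ : A → Carrier) →
      sum (φ ∘ lookup (tabulate f)) ≈ sum (φ ∘ f)
    sum-lookup-tabulate {zero}  f φ = refl
    sum-lookup-tabulate {suc n} f φ = +-congˡ (sum-lookup-tabulate (f ∘ suc) φ)

  sum-lookup-cartesianProduct : ∀ {a b} {A : Set a} {B : Set b} (φ : A × B → Carrier) → ∀ xs ys →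
    sum (φ ∘ lookup (cartesianProduct xs ys)) ≈ sum (λ i → sum (λ j → φ (lookup xs i , lookup ys j)))
  sum-lookup-cartesianProduct φ []       ys = refl
  sum-lookup-cartesianProduct φ (x ∷ xs) ys = trans (sum-lookup-++ φ (List.map (x ,_) ys) _)
    (∙-cong (sum-lookup-map (x ,_) φ ys) (sum-lookup-cartesianProduct φ xs ys))

  sum-allFin-filter : ∀ {n p} {P : Pred (Fin n) p} (P? : Decidable P) (φ : Fin n → Carrier) →
    sum (φ ∘ lookup (filter P? (allFin n))) ≈ sum (λ i → if does (P? i) then φ i else 0#)
  sum-allFin-filter {n} P? φ = trans (sum-lookup-filter P? φ (allFin n))
    (sum-lookup-tabulate {n = n} id (λ i → if does (P? i) then φ i else 0#))

  -- `edges` is a list of this shape, so sums over edge indices become double sums over vertices.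
  sum-allPairs-filter : ∀ {n p} {P : Pred (Fin n × Fin n) p} (P? : Decidable P) (φ : Fin n × Fin n → Carrier) →
    sum (φ ∘ lookup (filter P? (cartesianProduct (allFin n) (allFin n))))
    ≈ sum (λ i → sum (λ j → if does (P? (i , j)) then φ (i , j) else 0#))
  sum-allPairs-filter {n} P? φ = trans (sum-lookup-filter P? φ (cartesianProduct (allFin n) (allFin n)))
    (trans (sum-lookup-cartesianProduct ψ (allFin n) (allFin n))
    (trans (sum-lookup-tabulate {n = n} id (λ i → sum (λ j → ψ (i , lookup (allFin n) j))))
           (sum-cong-≋ {n} (λ i → sum-lookup-tabulate {n = n} id (λ j → ψ (i , j))))))
    where
    ψ : Fin n × Fin n → Carrier
    ψ ij = if does (P? ij) then φ ij else 0#

-- König's theorem for bipartite graphs.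

module BipartiteMatching where

  open import Data.Nat.Base using (_+_; _≤_)
  open import Algebra.Properties.CommutativeMonoid.Sum ℕ.+-0-commutativeMonoid
    using (sum; sum-cong-≗; sum-replicate-zero; ∑-distrib-+)
  open FiniteSums ℕ.+-0-commutativeMonoid

  𝟙 : Bool → ℕ
  𝟙 b = if b then 1 else 0

  count : ∀ {n} → (Fin n → Bool) → ℕ
  count A = sum (𝟙 ∘ A)

  count-modular : ∀ {n} (A B : Fin n → Bool) →
    count (λ i → A i ∧ B i) + count (λ i → A i ∨ B i) ≡ count A + count B
  count-modular {n} A B = ≡.trans (≡.sym (∑-distrib-+ {n} _ _))
    (≡.trans (sum-cong-≗ {n} (λ i → 𝟙-modular (A i) (B i))) (∑-distrib-+ {n} (𝟙 ∘ A) (𝟙 ∘ B)))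
    where
    𝟙-modular : ∀ a b → 𝟙 (a ∧ b) + 𝟙 (a ∨ b) ≡ 𝟙 a + 𝟙 b
    𝟙-modular true  true  = ≡.refl
    𝟙-modular true  false = ≡.refl
    𝟙-modular false b     = ≡.refl

  insert : ∀ {n} → Fin n → (Fin n → Bool) → Fin n → Bool
  insert a A i = does (i Fin.≟ a) ∨ A i

  insert-∋ : ∀ {n} (a : Fin n) A → insert a A a ≡ true
  insert-∋ a A = ≡.cong (_∨ A a) (dec-true (a Fin.≟ a) ≡.refl)

  insert-⊇ : ∀ {n} (a : Fin n) A {i} → A i ≡ true → insert a A i ≡ true
  insert-⊇ a A {i} Ai with does (i Fin.≟ a)
  ... | true  = ≡.refl
  ... | false = Ai

  count-insert : ∀ {n} (a : Fin n) A → count (insert a A) ≤ suc (count A)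
  count-insert a A = begin
    count (insert a A)                                  ≤⟨ ℕ.m≤n+m _ _ ⟩
    count (λ i → does (i Fin.≟ a) ∧ A i) + count (insert a A)
                                                        ≡⟨ count-modular (λ i → does (i Fin.≟ a)) A ⟩
    count (λ i → does (i Fin.≟ a)) + count A            ≡⟨ ≡.cong (_+ count A) (sum-δ′ a (λ _ → 1)) ⟩
    suc (count A)                                       ∎
    where open ℕ.≤-Reasoning

  module _ {m n : ℕ} where

    IsCover : List (Fin m × Fin n) → (Fin m → Bool) → (Fin n → Bool) → Set
    IsCover E A B = ∀ {i j} → (i , j) ∈ E → A i ≡ true ⊎ B j ≡ true

    -- Natural entries with row and column sums at most 1 are 0 or 1, so M is the indicator of a set
    -- of pairs, and its size is a double sum.
    record IsMatching (E : List (Fin m × Fin n)) (M : Fin m → Fin n → ℕ) : Set where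
      field
        support : ∀ i j → (i , j) ∉ E → M i j ≡ 0
        row≤1   : ∀ i → sum (M i) ≤ 1
        column≤1 : ∀ j → sum (λ i → M i j) ≤ 1

    open IsMatching

    size : (Fin m → Fin n → ℕ) → ℕ
    size M = sum (λ i → sum (M i))

    IsMatching-∷ : ∀ {e E M} → IsMatching E M → IsMatching (e ∷ E) M
    IsMatching-∷ mat = record
      { support = λ i j ∉ → support mat i j (∉ ∘ there) ; row≤1 = row≤1 mat ; column≤1 = column≤1 mat }

    -- If neither cover contains the column j, then both must contain the row i. The next lemma is
    -- the same with rows and columns exchanged.
    meet-join-cover : ∀ {E A B A′ B′} → IsCover E A B → IsCover E A′ B′ →
                      IsCover E (λ i → A i ∧ A′ i) (λ j → B j ∨ B′ j)
    meet-join-cover {E} {A} {B} {A′} {B′} C C′ {i} {j} ij∈E with A i | A′ i | B j | B′ j | C ij∈E | C′ ij∈E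
    ... | true | true | _     | _    | _      | _      = inj₁ ≡.refl
    ... | _    | _    | true  | _    | _      | _      = inj₂ ≡.refl
    ... | _    | _    | false | true | _      | _      = inj₂ ≡.refl
    ... | false | _    | false | false | inj₁ () | _
    ... | true | false | false | false | _ | inj₁ ()

    join-meet-cover : ∀ {E A B A′ B′} → IsCover E A B → IsCover E A′ B′ →
                      IsCover E (λ i → A i ∨ A′ i) (λ j → B j ∧ B′ j)
    join-meet-cover {E} {A} {B} {A′} {B′} C C′ {i} {j} ij∈E with A i | A′ i | B j | B′ j | C ij∈E | C′ ij∈E
    ... | true | _ | _     | _    | _      | _      = inj₁ ≡.refl
    ... | false | true | _     | _    | _      | _      = inj₁ ≡.refl
    ... | false | false | true | true | _ | _ = inj₂ ≡.refl
    ... | false | false | false | _ | _ | inj₁ ()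
    ... | false | false | false | _ | inj₂ () | _
    ... | false | false | true | false | _ | inj₂ ()

    module _ (a : Fin m) (b : Fin n) where

      Avoids : Pred (Fin m × Fin n) _
      Avoids (i , j) = i ≢ a × j ≢ b

      avoids? : Decidable Avoids
      avoids? (i , j) = ¬? (i Fin.≟ a) ×-dec ¬? (j Fin.≟ b)

      delete : List (Fin m × Fin n) → List (Fin m × Fin n)
      delete = filter avoids?

      edgeMatrix : Fin m → Fin n → ℕ
      edgeMatrix i j = if does (i Fin.≟ a) then 𝟙 (does (j Fin.≟ b)) else 0

      edgeMatrix-row : ∀ i → sum (edgeMatrix i) ≡ 𝟙 (does (i Fin.≟ a))
      edgeMatrix-row i with does (i Fin.≟ a)
      ... | true  = sum-δ′ b (λ _ → 1)
      ... | false = sum-replicate-zero n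

      edgeMatrix-column : ∀ j → sum (λ i → edgeMatrix i j) ≡ 𝟙 (does (j Fin.≟ b))
      edgeMatrix-column j = sum-δ′ a (λ _ → 𝟙 (does (j Fin.≟ b)))

      add-edge : (Fin m → Fin n → ℕ) → Fin m → Fin n → ℕ
      add-edge M i j = M i j + edgeMatrix i j

      -- A matching of `delete E` vanishes on row a and column b by its support, so the new unit
      -- entry is alone in its row and column.
      add-edge-matching : ∀ {E M} → IsMatching (delete E) M → IsMatching ((a , b) ∷ E) (add-edge M)
      add-edge-matching {E} {M} mat = record { support = support′ ; row≤1 = row ; column≤1 = column }
        where
        open ℕ.≤-Reasoning
        support′ : ∀ i j → (i , j) ∉ (a , b) ∷ E → M i j + edgeMatrix i j ≡ 0
        support′ i j ∉ = ≡.cong₂ _+_ (support mat i j (∉ ∘ there ∘ proj₁ ∘ ∈-filter⁻ avoids?)) entry≡0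
          where
          entry≡0 : edgeMatrix i j ≡ 0
          entry≡0 with i Fin.≟ a | j Fin.≟ b
          ... | no  _      | _          = ≡.refl
          ... | yes _      | no _       = ≡.refl
          ... | yes ≡.refl | yes ≡.refl = contradiction (here ≡.refl) ∉
        row : ∀ i → sum (λ j → M i j + edgeMatrix i j) ≤ 1
        row i = begin
          sum (λ j → M i j + edgeMatrix i j)             ≡⟨ ∑-distrib-+ {n} (M i) (edgeMatrix i) ⟩
          sum (M i) + sum (edgeMatrix i)                 ≡⟨ ≡.cong (sum (M i) +_) (edgeMatrix-row i) ⟩
          sum (M i) + 𝟙 (does (i Fin.≟ a))      ≤⟨ bound ⟩
          1                                     ∎
          where
          bound : sum (M i) + 𝟙 (does (i Fin.≟ a)) ≤ 1
          bound with i Fin.≟ a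
          ... | yes i≡a = ℕ.≤-reflexive (≡.cong (_+ 1) (≡.trans
                (sum-cong-≗ {n} (λ j → support mat i j (λ ij∈ → proj₁ (proj₂ (∈-filter⁻ avoids? {xs = E} ij∈)) i≡a)))
                (sum-replicate-zero n)))
          ... | no  _   = ℕ.≤-trans (ℕ.≤-reflexive (ℕ.+-identityʳ _)) (row≤1 mat i)
        column : ∀ j → sum (λ i → M i j + edgeMatrix i j) ≤ 1
        column j = begin
          sum (λ i → M i j + edgeMatrix i j)                ≡⟨ ∑-distrib-+ {m} (λ i → M i j) (λ i → edgeMatrix i j) ⟩
          sum (λ i → M i j) + sum (λ i → edgeMatrix i j)    ≡⟨ ≡.cong (sum (λ i → M i j) +_) (edgeMatrix-column j) ⟩
          sum (λ i → M i j) + 𝟙 (does (j Fin.≟ b))          ≤⟨ bound ⟩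
          1                                                 ∎
          where
          bound : sum (λ i → M i j) + 𝟙 (does (j Fin.≟ b)) ≤ 1
          bound with j Fin.≟ b
          ... | yes j≡b = ℕ.≤-reflexive (≡.cong (_+ 1) (≡.trans
                (sum-cong-≗ {m} (λ i → support mat i j (λ ij∈ → proj₂ (proj₂ (∈-filter⁻ avoids? {xs = E} ij∈)) j≡b)))
                (sum-replicate-zero m)))
          ... | no  _   = ℕ.≤-trans (ℕ.≤-reflexive (ℕ.+-identityʳ _)) (column≤1 mat j)

      size-add-edge : ∀ M → size (add-edge M) ≡ suc (size M)
      size-add-edge M = begin
        sum (λ i → sum (λ j → M i j + edgeMatrix i j))
          ≡⟨ sum-cong-≗ {m} (λ i → ≡.trans (∑-distrib-+ {n} (M i) (edgeMatrix i)) (≡.cong (sum (M i) +_) (edgeMatrix-row i))) ⟩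
        sum (λ i → sum (M i) + 𝟙 (does (i Fin.≟ a)))                  ≡⟨ ∑-distrib-+ {m} (λ i → sum (M i)) _ ⟩
        size M + sum (λ i → 𝟙 (does (i Fin.≟ a)))                     ≡⟨ ≡.cong (size M +_) (sum-δ′ a (λ _ → 1)) ⟩
        size M + 1                                                    ≡⟨ ℕ.+-comm (size M) 1 ⟩
        suc (size M)                                                  ∎
        where open ≡.≡-Reasoning

      insert-cover : ∀ {E A B} → IsCover (delete E) A B → IsCover E (insert a A) (insert b B)
      insert-cover {E} {A} {B} C {i} {j} ij∈E with i Fin.≟ a | j Fin.≟ b
      ... | yes _   | _       = inj₁ ≡.refl
      ... | no  _   | yes _   = inj₂ ≡.refl
      ... | no  i≢a | no  j≢b = C (∈-filter⁺ avoids? ij∈E (i≢a , j≢b))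

    -- The stored inequality is the one that König's theorem supplies; the opposite comparison is
    -- made for fractional matchings in `matching≤cover`.
    record TightPair (E : List (Fin m × Fin n)) : Set where
      constructor tightPair
      field
        {M}      : Fin m → Fin n → ℕ
        {A}      : Fin m → Bool
        {B}      : Fin n → Bool
        matching : IsMatching E M
        cover    : IsCover E A B
        tight    : count A + count B ≤ size M

    -- Let (M₁, C₁) be tight for E and (M₂, C₂) for E without the rows and columns of e = (a , b).
    -- If C₁ misses e and |M₂| < |M₁|, then C₁ and C₂ ∪ {a , b} have total size at most 2 |M₁| + 1,
    -- and uncrossing them gives two covers of e ∷ E.
    extend : ∀ a b {E} → TightPair E → TightPair (delete a b E) → TightPair ((a , b) ∷ E)
    extend a b {E} (tightPair {M₁} {A₁} {B₁} mat₁ cov₁ tight₁) (tightPair {M₂} {A₂} {B₂} mat₂ cov₂ tight₂)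
      with size M₁ ℕ.≤? size M₂
    -- Adding (a , b) to M₂ gives a matching larger than M₁, which pays for adding a to the first
    -- cover.
    ... | yes M₁≤M₂ = tightPair (add-edge-matching a b mat₂)
          (λ { (here ≡.refl) → inj₁ (insert-∋ a A₁)
             ; (there ij∈E)  → Sum.map₁ (insert-⊇ a A₁) (cov₁ ij∈E) })
          (begin
            count (insert a A₁) + count B₁  ≤⟨ ℕ.+-monoˡ-≤ (count B₁) (count-insert a A₁) ⟩
            suc (count A₁ + count B₁)       ≤⟨ ℕ.s≤s (ℕ.≤-trans tight₁ M₁≤M₂) ⟩
            suc (size M₂)                   ≡⟨ size-add-edge a b M₂ ⟨
            size (add-edge a b M₂)          ∎)
      where open ℕ.≤-Reasoning
    -- X and Y have sum at most 2 |M₁| + 1, so they cannot both exceed |M₁|. Either uncrossed cover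
    -- catches the new edge: one has b in its join of columns, the other a in its join of rows.
    ... | no M₁≰M₂ = case X ℕ.≤? size M₁ of λ where
          (yes X≤M₁) → tightPair (IsMatching-∷ mat₁)
            (λ { (here ≡.refl) → inj₂ (≡.trans (≡.cong (B₁ b ∨_) (insert-∋ b B₂)) (Bool.∨-zeroʳ (B₁ b)))
               ; (there ij∈E)  → meet-join-cover {A = A₁} {B₁} {A₂′} {B₂′} cov₁ cov₂′ ij∈E }) X≤M₁
          (no X≰M₁) → tightPair (IsMatching-∷ mat₁)
            (λ { (here ≡.refl) → inj₁ (≡.trans (≡.cong (A₁ a ∨_) (insert-∋ a A₂)) (Bool.∨-zeroʳ (A₁ a)))
               ; (there ij∈E)  → join-meet-cover {A = A₁} {B₁} {A₂′} {B₂′} cov₁ cov₂′ ij∈E })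
            (ℕ.+-cancelˡ-≤ (suc (size M₁)) _ _ (begin
              suc (size M₁) + Y                ≤⟨ ℕ.+-monoˡ-≤ Y (ℕ.≰⇒> X≰M₁) ⟩
              X + Y                            ≤⟨ X+Y≤ ⟩
              suc (size M₁) + size M₁          ∎))
      where
      open +-*-Solver using (solve; _:=_; _:+_; con)
      open ℕ.≤-Reasoning
      A₂′ = insert a A₂
      B₂′ = insert b B₂
      cov₂′ : IsCover E A₂′ B₂′
      cov₂′ = insert-cover a b cov₂
      X = count (λ i → A₁ i ∧ A₂′ i) + count (λ j → B₁ j ∨ B₂′ j)
      Y = count (λ i → A₁ i ∨ A₂′ i) + count (λ j → B₁ j ∧ B₂′ j)
      X+Y≤ : X + Y ≤ suc (size M₁) + size M₁
      X+Y≤ = begin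
        X + Y
          ≡⟨ solve 4 (λ x y z w → (x :+ y) :+ (z :+ w) := (x :+ z) :+ (w :+ y)) ≡.refl
               (count (λ i → A₁ i ∧ A₂′ i)) (count (λ j → B₁ j ∨ B₂′ j))
               (count (λ i → A₁ i ∨ A₂′ i)) (count (λ j → B₁ j ∧ B₂′ j)) ⟩
        (count (λ i → A₁ i ∧ A₂′ i) + count (λ i → A₁ i ∨ A₂′ i))
          + (count (λ j → B₁ j ∧ B₂′ j) + count (λ j → B₁ j ∨ B₂′ j))
          ≡⟨ ≡.cong₂ _+_ (count-modular A₁ A₂′) (count-modular B₁ B₂′) ⟩
        (count A₁ + count A₂′) + (count B₁ + count B₂′)
          ≤⟨ ℕ.+-mono-≤ (ℕ.+-monoʳ-≤ (count A₁) (count-insert a A₂)) (ℕ.+-monoʳ-≤ (count B₁) (count-insert b B₂)) ⟩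
        (count A₁ + suc (count A₂)) + (count B₁ + suc (count B₂))
          ≡⟨ solve 4 (λ x y z w → (x :+ (con 1 :+ y)) :+ (z :+ (con 1 :+ w)) := (x :+ z) :+ (con 2 :+ (y :+ w))) ≡.refl
               (count A₁) (count A₂) (count B₁) (count B₂) ⟩
        (count A₁ + count B₁) + (2 + (count A₂ + count B₂))
          ≤⟨ ℕ.+-mono-≤ tight₁ (ℕ.+-monoʳ-≤ 2 tight₂) ⟩
        size M₁ + (2 + size M₂)
          ≤⟨ ℕ.+-monoʳ-≤ (size M₁) (ℕ.s≤s (ℕ.≰⇒> M₁≰M₂)) ⟩
        size M₁ + suc (size M₁)
          ≡⟨ ℕ.+-comm (size M₁) (suc (size M₁)) ⟩
        suc (size M₁) + size M₁ ∎

    private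
      -- Induction on a bound for the length, because `delete a b E` is a filtered list and not a
      -- subterm.
      könig′ : ∀ k E → length E ≤ k → TightPair E
      könig′ k [] _ = tightPair {M = λ _ _ → 0} {A = λ _ → false} {B = λ _ → false}
        (record
          { support = λ _ _ _ → ≡.refl
          ; row≤1 = λ _ → ℕ.≤-trans (ℕ.≤-reflexive (sum-replicate-zero n)) ℕ.z≤n
          ; column≤1 = λ _ → ℕ.≤-trans (ℕ.≤-reflexive (sum-replicate-zero m)) ℕ.z≤n
          })
        (λ ()) (ℕ.≤-trans (ℕ.≤-reflexive (≡.cong₂ _+_ (sum-replicate-zero m) (sum-replicate-zero n))) ℕ.z≤n)
      könig′ (suc k) ((a , b) ∷ E) (ℕ.s≤s E≤k) = extend a b (könig′ k E E≤k)
        (könig′ k (delete a b E) (ℕ.≤-trans (List.length-filter (avoids? a b) E) E≤k))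

    könig : ∀ E → TightPair E
    könig E = könig′ (length E) E ℕ.≤-refl

-- Inequalities and sums in an ordered field.

module OrderedField (ℝ : CompleteOrderedField) where

  open import Data.Integer.Base using (+_)
  open CompleteOrderedField ℝ hiding (zero)
  open IntegerCoefficients commutativeRing using (module Solver)
  open Solver
  open import Algebra.Properties.Semiring.Sum semiring
    using (sum-cong-≋; sum-replicate-zero; ∑-distrib-+; *-distribˡ-sum)

  decTotalOrder : DecTotalOrder 0ℓ 0ℓ 0ℓ
  decTotalOrder = record { isDecTotalOrder = isDecTotalOrder }

  open DecTotalOrder decTotalOrder public
    using (total; antisym; _≟_; poset; ≤-respʳ-≈; ≤-respˡ-≈)
    renaming (refl to ≤-refl; reflexive to ≤-reflexive; trans to ≤-trans)

  module ≤-Reasoning = Relation.Binary.Reasoning.PartialOrder poset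
  module ≈-Reasoning = Relation.Binary.Reasoning.Setoid setoid

  -- Many inequalities below are proved by naming the nonnegative gap d, which leaves a polynomial
  -- identity to the ring solver.
  0≤⇒≤ : ∀ {x y} d → 0# ≤ d → x + d ≈ y → x ≤ y
  0≤⇒≤ {x} {y} d 0≤d x+d≈y = begin
    x       ≈⟨ +-identityʳ x ⟨
    x + 0#  ≤⟨ +-monoʳ-≤ x 0≤d ⟩
    x + d   ≈⟨ x+d≈y ⟩
    y       ∎
    where open ≤-Reasoning

  ≤⇒0≤ : ∀ {x y} → x ≤ y → 0# ≤ y - x
  ≤⇒0≤ {x} {y} x≤y = begin
    0#      ≈⟨ -‿inverseˡ x ⟨
    - x + x ≤⟨ +-monoʳ-≤ (- x) x≤y ⟩
    - x + y ≈⟨ +-comm _ _ ⟩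
    y - x   ∎
    where open ≤-Reasoning

  ≰⇒≥ : ∀ {x y} → ¬ x ≤ y → y ≤ x
  ≰⇒≥ {x} {y} x≰y with total x y
  ... | inj₁ x≤y = contradiction x≤y x≰y
  ... | inj₂ y≤x = y≤x

  +-mono-≤ : ∀ {x y u v} → x ≤ y → u ≤ v → x + u ≤ y + v
  +-mono-≤ {x} {y} {u} {v} x≤y u≤v = begin
    x + u  ≤⟨ +-monoʳ-≤ x u≤v ⟩
    x + v  ≈⟨ +-comm _ _ ⟩
    v + x  ≤⟨ +-monoʳ-≤ v x≤y ⟩
    v + y  ≈⟨ +-comm _ _ ⟩
    y + v  ∎
    where open ≤-Reasoning

  +-nonNegative : ∀ {x y} → 0# ≤ x → 0# ≤ y → 0# ≤ x + y
  +-nonNegative 0≤x 0≤y = ≤-respˡ-≈ (+-identityˡ 0#) (+-mono-≤ 0≤x 0≤y)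

  *-monoˡ-≤ : ∀ {x y} c → 0# ≤ c → x ≤ y → c * x ≤ c * y
  *-monoˡ-≤ {x} {y} c 0≤c x≤y = 0≤⇒≤ (c * (y - x)) (*-nonNegative 0≤c (≤⇒0≤ x≤y))
    (solve 3 (λ c x y → c :* x :+ c :* (y :- x) := c :* y) refl c x y)

  *-monoʳ-≤ : ∀ {x y} c → 0# ≤ c → x ≤ y → x * c ≤ y * c
  *-monoʳ-≤ {x} {y} c 0≤c x≤y = 0≤⇒≤ ((y - x) * c) (*-nonNegative (≤⇒0≤ x≤y) 0≤c)
    (solve 3 (λ c x y → x :* c :+ (y :- x) :* c := y :* c) refl c x y)

  0≤x² : ∀ x → 0# ≤ x * x
  0≤x² x with total 0# x
  ... | inj₁ 0≤x = *-nonNegative 0≤x 0≤x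
  ... | inj₂ x≤0 = ≤-respʳ-≈ (solve 1 (λ x → (con (+ 0) :- x) :* (con (+ 0) :- x) := x :* x) refl x)
                             (*-nonNegative (≤⇒0≤ x≤0) (≤⇒0≤ x≤0))

  0≤1 : 0# ≤ 1#
  0≤1 = ≤-respʳ-≈ (*-identityˡ 1#) (0≤x² 1#)

  0≰-1 : ¬ 0# ≤ - 1#
  0≰-1 0≤-1 = 0≉1 (antisym 0≤1 (0≤⇒≤ (- 1#) 0≤-1 (-‿inverseʳ 1#)))

  0≤2x⇒0≤x : ∀ {x} → 0# ≤ x + x → 0# ≤ x
  0≤2x⇒0≤x {x} 0≤2x with total 0# x
  ... | inj₁ 0≤x = 0≤x
  ... | inj₂ x≤0 = ≤-respʳ-≈ (solve 1 (λ x → x :+ x :+ (con (+ 0) :- x) := x) refl x)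
                             (+-nonNegative 0≤2x (≤⇒0≤ x≤0))

  0≤fromℕ : ∀ m → 0# ≤ fromℕ m
  0≤fromℕ zero    = ≤-refl
  0≤fromℕ (suc m) = +-nonNegative 0≤1 (0≤fromℕ m)

  0≤x⁻¹ : ∀ {x} → 0# ≤ x → ¬ x ≈ 0# → 0# ≤ x ⁻¹
  0≤x⁻¹ {x} 0≤x x≉0 = ≤-respʳ-≈ x[x⁻¹]²≈x⁻¹ (*-nonNegative 0≤x (0≤x² (x ⁻¹)))
    where
    x[x⁻¹]²≈x⁻¹ : x * (x ⁻¹ * x ⁻¹) ≈ x ⁻¹
    x[x⁻¹]²≈x⁻¹ = trans (sym (*-assoc _ _ _)) (trans (*-congʳ (⁻¹-inverseʳ x x≉0)) (*-identityˡ _))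

  *-cancelʳ-≤ : ∀ {x y z} → 0# ≤ z → ¬ z ≈ 0# → x * z ≤ y * z → x ≤ y
  *-cancelʳ-≤ {x} {y} {z} 0≤z z≉0 xz≤yz = begin
    x               ≈⟨ x[zz⁻¹]≈x x ⟨
    x * z * z ⁻¹    ≤⟨ *-monoʳ-≤ (z ⁻¹) (0≤x⁻¹ 0≤z z≉0) xz≤yz ⟩
    y * z * z ⁻¹    ≈⟨ x[zz⁻¹]≈x y ⟩
    y               ∎
    where
    open ≤-Reasoning
    x[zz⁻¹]≈x : ∀ x → x * z * z ⁻¹ ≈ x
    x[zz⁻¹]≈x x = trans (*-assoc _ _ _) (trans (*-congˡ (⁻¹-inverseʳ z z≉0)) (*-identityʳ x))

  -- Twice the gap is (x - y)² + x² + y². The constant 1 in place of 1/2 keeps the statement free of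
  -- division.
  x*y≤x²+y² : ∀ x y → x * y ≤ x * x + y * y
  x*y≤x²+y² x y = 0≤⇒≤ d
    (0≤2x⇒0≤x (≤-respʳ-≈
      (solve 2 (λ x y → (x :- y) :* (x :- y) :+ x :* x :+ y :* y
                  := x :* x :+ y :* y :- x :* y :+ (x :* x :+ y :* y :- x :* y)) refl x y)
      (+-nonNegative (+-nonNegative (0≤x² (x - y)) (0≤x² x)) (0≤x² y))))
    (solve 2 (λ x y → x :* y :+ (x :* x :+ y :* y :- x :* y) := x :* x :+ y :* y) refl x y)
    where d = x * x + y * y - x * y

  x²≈0⇒x≈0 : ∀ {x} → x * x ≈ 0# → x ≈ 0#
  x²≈0⇒x≈0 {x} x²≈0 with x ≟ 0#
  ... | yes x≈0 = x≈0
  ... | no  x≉0 = begin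
    x               ≈⟨ *-identityʳ x ⟨
    x * 1#          ≈⟨ *-congˡ (⁻¹-inverseʳ x x≉0) ⟨
    x * (x * x ⁻¹)  ≈⟨ *-assoc _ _ _ ⟨
    x * x * x ⁻¹    ≈⟨ *-congʳ x²≈0 ⟩
    0# * x ⁻¹       ≈⟨ zeroˡ _ ⟩
    0#              ∎
    where open ≈-Reasoning

  sum-zero : ∀ {n} {f : Vector Carrier n} → (∀ i → f i ≈ 0#) → sum f ≈ 0#
  sum-zero {n} f≈0 = trans (sum-cong-≋ f≈0) (sum-replicate-zero n)

  sum-linear : ∀ {n} (f g : Vector Carrier n) c → ∑[ i < n ] (f i + c * g i) ≈ sum f + c * sum g
  sum-linear f g c = trans (∑-distrib-+ f (λ i → c * g i)) (+-congˡ (sym (*-distribˡ-sum c g)))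

  sum-mono-≤ : ∀ {n} {f g : Vector Carrier n} → (∀ i → f i ≤ g i) → sum f ≤ sum g
  sum-mono-≤ {zero}  f≤g = ≤-refl
  sum-mono-≤ {suc n} f≤g = +-mono-≤ (f≤g zero) (sum-mono-≤ (f≤g ∘ suc))

  sum-nonNegative : ∀ {n} {f : Vector Carrier n} → (∀ i → 0# ≤ f i) → 0# ≤ sum f
  sum-nonNegative {zero}  0≤f = ≤-refl
  sum-nonNegative {suc n} 0≤f = +-nonNegative (0≤f zero) (sum-nonNegative (0≤f ∘ suc))

  term≤sum : ∀ {n} {f : Vector Carrier n} → (∀ i → 0# ≤ f i) → ∀ i → f i ≤ sum f
  term≤sum 0≤f zero    = 0≤⇒≤ _ (sum-nonNegative (0≤f ∘ suc)) refl
  term≤sum 0≤f (suc i) = ≤-trans (term≤sum (0≤f ∘ suc) i) (0≤⇒≤ _ (0≤f zero) (+-comm _ _))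

-- Positive semidefinite forms and Schur complements.

module QuadraticForms (ℝ : CompleteOrderedField) where

  open import Data.Integer.Base using (+_)
  open CompleteOrderedField ℝ hiding (zero)
  open RealGraphTheory ℝ
  open IntegerCoefficients commutativeRing using (module Solver)
  open Solver
  open import Algebra.Properties.Semiring.Sum semiring
    using (sum-cong-≋; ∑-distrib-+; *-distribˡ-sum; *-distribʳ-sum)
  open OrderedField ℝ
  open FiniteSums +-commutativeMonoid

  infix 8 _∙_
  _∙_ : ∀ {n} → Vector Carrier n → Vector Carrier n → Carrier
  x ∙ y = sum (λ i → x i * y i)

  0≤x∙x : ∀ {n} (x : Vector Carrier n) → 0# ≤ x ∙ x
  0≤x∙x x = sum-nonNegative (λ i → 0≤x² (x i))

  x∙x≈0⇒x≈0 : ∀ {n} (x : Vector Carrier n) → x ∙ x ≈ 0# → ∀ i → x i ≈ 0#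
  x∙x≈0⇒x≈0 x x∙x≈0 i = x²≈0⇒x≈0 (antisym (≤-respʳ-≈ x∙x≈0 (term≤sum (λ i → 0≤x² (x i)) i)) (0≤x² (x i)))

  -- A weak Cauchy-Schwarz inequality: (u + v)² ≤ 2 u² + 2 v² turns the constant L of the tail into
  -- 2 b₀² + 2 L. Only the existence of some constant matters below.
  ∙-bound : ∀ {n} (b : Vector Carrier n) →
            ∃[ L ] (0# ≤ L × ∀ x → b ∙ x * b ∙ x ≤ L * x ∙ x)
  ∙-bound {zero}  b = 0# , ≤-refl , λ _ → ≤-reflexive refl
  ∙-bound {suc n} b with L , 0≤L , bound ← ∙-bound (b ∘ suc) =
    b₀² + b₀² + (L + L) , +-nonNegative (+-nonNegative (0≤x² b₀) (0≤x² b₀)) (+-nonNegative 0≤L 0≤L) ,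
    λ x → let x₀ = x zero ; l = (b ∘ suc) ∙ (x ∘ suc) ; s = (x ∘ suc) ∙ (x ∘ suc)
              gap = L * s - l * l
          in 0≤⇒≤ ((b₀ * x₀ - l) * (b₀ * x₀ - l) + (gap + gap)
                   + (b₀² * s + b₀² * s) + (L * (x₀ * x₀) + L * (x₀ * x₀)))
               (+-nonNegative (+-nonNegative (+-nonNegative (0≤x² _)
                 (+-nonNegative (≤⇒0≤ (bound (x ∘ suc))) (≤⇒0≤ (bound (x ∘ suc)))))
                 (+-nonNegative (*-nonNegative (0≤x² b₀) (0≤x∙x (x ∘ suc)))
                                (*-nonNegative (0≤x² b₀) (0≤x∙x (x ∘ suc)))))
                 (+-nonNegative (*-nonNegative 0≤L (0≤x² x₀)) (*-nonNegative 0≤L (0≤x² x₀))))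
               (solve 5 (λ b x l s L →
                  let g = L :* s :- l :* l in
                  (b :* x :+ l) :* (b :* x :+ l)
                  :+ ((b :* x :- l) :* (b :* x :- l) :+ (g :+ g)
                      :+ (b :* b :* s :+ b :* b :* s) :+ (L :* (x :* x) :+ L :* (x :* x)))
                  := (b :* b :+ b :* b :+ (L :+ L)) :* (x :* x :+ s)) refl b₀ x₀ l s L)
    where
    b₀ = b zero
    b₀² = b₀ * b₀

  infixr 8 _$_
  _$_ : ∀ {n} → Matrix {n} → Vector Carrier n → Vector Carrier n
  (N $ x) i = N i ∙ x

  SymmetricMatrix PositiveSemidefinite : ∀ {n} → Matrix {n} → Set
  SymmetricMatrix N = ∀ i j → N i j ≈ N j i
  PositiveSemidefinite N = ∀ x → 0# ≤ x ∙ (N $ x)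

  minor : ∀ {n} → Matrix {suc n} → Matrix {n}
  minor N i j = N (suc i) (suc j)

  form-split : ∀ {n} (N : Matrix {suc n}) → SymmetricMatrix N → ∀ x₀ x →
    let r = N zero ∘ suc in
    (x₀ ∷ᵛ x) ∙ (N $ (x₀ ∷ᵛ x)) ≈ N zero zero * x₀ * x₀ + (x₀ * r ∙ x + x₀ * r ∙ x) + x ∙ (minor N $ x)
  form-split {n} N N-sym x₀ x = begin
    x₀ * (p * x₀ + r ∙ x) + sum (λ i → x i * (N (suc i) zero * x₀ + (minor N $ x) i))
      ≈⟨ +-congˡ (sum-cong-≋ {n} (λ i → trans (*-congˡ (+-congʳ (*-congʳ (N-sym (suc i) zero))))
           (solve 4 (λ x r x₀ m → x :* (r :* x₀ :+ m) := x :* m :+ x₀ :* (r :* x))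
             refl (x i) (r i) x₀ ((minor N $ x) i)))) ⟩
    x₀ * (p * x₀ + r ∙ x) + sum (λ i → x i * (minor N $ x) i + x₀ * (r i * x i))
      ≈⟨ +-congˡ (sum-linear {n} _ _ x₀) ⟩
    x₀ * (p * x₀ + r ∙ x) + (x ∙ (minor N $ x) + x₀ * r ∙ x)
      ≈⟨ solve 4 (λ x₀ p l q → x₀ :* (p :* x₀ :+ l) :+ (q :+ x₀ :* l) := p :* x₀ :* x₀ :+ (x₀ :* l :+ x₀ :* l) :+ q)
           refl x₀ p (r ∙ x) (x ∙ (minor N $ x)) ⟩
    p * x₀ * x₀ + (x₀ * r ∙ x + x₀ * r ∙ x) + x ∙ (minor N $ x) ∎
    where
    open ≈-Reasoning
    p = N zero zero
    r = N zero ∘ suc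

  schur : ∀ {n} → Matrix {suc n} → Matrix {n}
  schur N i j = minor N i j + - (N zero (suc i) * N zero zero ⁻¹) * N zero (suc j)

  schur-$ : ∀ {n} (N : Matrix {suc n}) x i → let r = N zero ∘ suc in
    (schur N $ x) i ≈ (minor N $ x) i + - (r i * N zero zero ⁻¹) * r ∙ x
  schur-$ {n} N x i = trans
    (sum-cong-≋ {n} (λ j → solve 4 (λ m c r x → (m :+ c :* r) :* x := m :* x :+ c :* (r :* x)) refl
       (minor N i j) (- (N zero (suc i) * N zero zero ⁻¹)) (N zero (suc j)) (x j)))
    (sum-linear {n} _ _ _)

  schur-form : ∀ {n} (N : Matrix {suc n}) x → let r = N zero ∘ suc in
    x ∙ (schur N $ x) ≈ x ∙ (minor N $ x) + - (N zero zero ⁻¹ * r ∙ x) * r ∙ x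
  schur-form {n} N x = trans
    (sum-cong-≋ {n} (λ i → trans (*-congˡ (schur-$ N x i))
       (solve 5 (λ x m r w l → x :* (m :+ (:- (r :* w)) :* l) := x :* m :+ (:- (w :* l)) :* (r :* x)) refl
         (x i) ((minor N $ x) i) (N zero (suc i)) (N zero zero ⁻¹) ((N zero ∘ suc) ∙ x))))
    (sum-linear {n} _ _ _)

  -- Coercivity carries its constant on the side of the form, so K need only be nonnegative and no
  -- positive lower bound has to be inverted in the induction.
  Singular Coercive : ∀ {n} → Matrix {n} → Set
  Singular N = ∃[ x ] (¬ (∀ i → x i ≈ 0#) × ∀ i → (N $ x) i ≈ 0#)
  Coercive N = ∃[ K ] (0# ≤ K × ∀ x → x ∙ x ≤ K * x ∙ (N $ x))

  module _ {n} (N : Matrix {suc n}) (N-sym : SymmetricMatrix N) (N-psd : PositiveSemidefinite N) where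

    private
      p = N zero zero
      r = N zero ∘ suc
      w = p ⁻¹

    form-e₀ : (1# ∷ᵛ λ _ → 0#) ∙ (N $ (1# ∷ᵛ λ _ → 0#)) ≈ p
    form-e₀ = begin
      (1# ∷ᵛ λ _ → 0#) ∙ (N $ (1# ∷ᵛ λ _ → 0#))
        ≈⟨ form-split N N-sym 1# (λ _ → 0#) ⟩
      p * 1# * 1# + (1# * r ∙ (λ _ → 0#) + 1# * r ∙ (λ _ → 0#)) + (λ _ → 0#) ∙ (minor N $ λ _ → 0#)
        ≈⟨ +-cong (+-congˡ (+-cong (*-congˡ r∙0≈0) (*-congˡ r∙0≈0))) (sum-zero {n} (λ _ → zeroˡ _)) ⟩
      p * 1# * 1# + (1# * 0# + 1# * 0#) + 0#
        ≈⟨ solve 1 (λ p → p :* con (+ 1) :* con (+ 1) :+ (con (+ 1) :* con (+ 0) :+ con (+ 1) :* con (+ 0)) :+ con (+ 0)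
             := p) refl p ⟩
      p ∎
      where
      open ≈-Reasoning
      r∙0≈0 : r ∙ (λ _ → 0#) ≈ 0#
      r∙0≈0 = sum-zero {n} (λ _ → zeroʳ _)

    0≤p : 0# ≤ p
    0≤p = ≤-respʳ-≈ form-e₀ (N-psd (1# ∷ᵛ λ _ → 0#))

    0≤form-minor : ∀ x → 0# ≤ x ∙ (minor N $ x)
    0≤form-minor x = ≤-respʳ-≈ (begin
      (0# ∷ᵛ x) ∙ (N $ (0# ∷ᵛ x))
        ≈⟨ form-split N N-sym 0# x ⟩
      p * 0# * 0# + (0# * r ∙ x + 0# * r ∙ x) + x ∙ (minor N $ x)
        ≈⟨ solve 3 (λ p l q → p :* con (+ 0) :* con (+ 0) :+ (con (+ 0) :* l :+ con (+ 0) :* l) :+ q := q) refl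
             p (r ∙ x) (x ∙ (minor N $ x)) ⟩
      x ∙ (minor N $ x) ∎) (N-psd (0# ∷ᵛ x))
      where open ≈-Reasoning

    -- The form at (t, r) is affine in t with slope 2 (r ∙ r), hence negative for some t unless r ≈ 0.
    p≈0⇒r≈0 : p ≈ 0# → ∀ i → r i ≈ 0#
    p≈0⇒r≈0 p≈0 = x∙x≈0⇒x≈0 r (decidable-stable (r ∙ r ≟ 0#) λ ρ≉0 →
      let ρ = r ∙ r
          q = r ∙ (minor N $ r)
          -- Since p vanishes, the form at (t , r) is 2 t ρ + q, which this t makes equal to - (q +
          -- 2). Adding the nonnegative q + 1 then leaves exactly -1.
          t = - ((q + 1#) * ρ ⁻¹)
      in 0≰-1 (≤-respʳ-≈
        (begin
          (t ∷ᵛ r) ∙ (N $ (t ∷ᵛ r)) + (q + 1#)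
            ≈⟨ +-congʳ (form-split N N-sym t r) ⟩
          p * t * t + (t * ρ + t * ρ) + q + (q + 1#)
            ≈⟨ +-congʳ (+-congʳ (+-congʳ (*-congʳ (*-congʳ p≈0)))) ⟩
          0# * t * t + (t * ρ + t * ρ) + q + (q + 1#)
            ≈⟨ solve 3 (λ ρ w q → let t = :- ((q :+ con (+ 1)) :* w) in
                 con (+ 0) :* t :* t :+ (t :* ρ :+ t :* ρ) :+ q :+ (q :+ con (+ 1))
                 := (q :+ q :+ con (+ 1)) :+ :- ((ρ :* w) :* (q :+ q :+ con (+ 2)))) refl ρ (ρ ⁻¹) q ⟩
          (q + q + 1#) - (ρ * ρ ⁻¹) * (q + q + (1# + 1#))
            ≈⟨ +-congˡ (-‿cong (*-congʳ (⁻¹-inverseʳ ρ ρ≉0))) ⟩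
          (q + q + 1#) - 1# * (q + q + (1# + 1#))
            ≈⟨ solve 1 (λ q → (q :+ q :+ con (+ 1)) :- con (+ 1) :* (q :+ q :+ con (+ 2)) := :- con (+ 1)) refl q ⟩
          - 1# ∎)
        (+-nonNegative (N-psd (t ∷ᵛ r)) (+-nonNegative (0≤form-minor r) 0≤1))))
      where open ≈-Reasoning

    p≈0⇒singular : p ≈ 0# → Singular N
    p≈0⇒singular p≈0 = e₀ , (λ e₀≈0 → 0≉1 (sym (e₀≈0 zero))) , Ne₀≈0
      where
      e₀ = 1# ∷ᵛ λ _ → 0#
      column≈0 : ∀ i → N i zero ≈ 0#
      column≈0 zero    = p≈0
      column≈0 (suc i) = trans (N-sym (suc i) zero) (p≈0⇒r≈0 p≈0 i)
      Ne₀≈0 : ∀ i → (N $ e₀) i ≈ 0#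
      Ne₀≈0 i = trans (+-cong (trans (*-identityʳ _) (column≈0 i)) (sum-zero {n} (λ _ → zeroʳ _))) (+-identityˡ 0#)

    module _ (p≉0 : ¬ p ≈ 0#) where

      private
        pw≈1 : p * w ≈ 1#
        pw≈1 = ⁻¹-inverseʳ p p≉0

        0≤w : 0# ≤ w
        0≤w = 0≤x⁻¹ 0≤p p≉0

      schur-sym : SymmetricMatrix (schur N)
      schur-sym i j = +-cong (N-sym (suc i) (suc j))
        (solve 3 (λ a b w → (:- (a :* w)) :* b := (:- (b :* w)) :* a) refl (r i) (r j) w)

      complete-square : ∀ x₀ x → let y = x₀ + w * r ∙ x in
        (x₀ ∷ᵛ x) ∙ (N $ (x₀ ∷ᵛ x)) ≈ p * (y * y) + x ∙ (schur N $ x)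
      complete-square x₀ x = begin
        (x₀ ∷ᵛ x) ∙ (N $ (x₀ ∷ᵛ x))
          ≈⟨ form-split N N-sym x₀ x ⟩
        p * x₀ * x₀ + (x₀ * l + x₀ * l) + q
          -- The term w l² is added and subtracted. The solver cannot use p w ≈ 1, so a factor 1 is
          -- planted here and replaced by p w in the next step.
          ≈⟨ solve 5 (λ p w x₀ l q → p :* x₀ :* x₀ :+ (x₀ :* l :+ x₀ :* l) :+ q
               := p :* x₀ :* x₀ :+ con (+ 1) :* (x₀ :* l :+ x₀ :* l :+ w :* l :* l) :+ (q :+ (:- (w :* l)) :* l)) refl
               p w x₀ l q ⟩
        p * x₀ * x₀ + 1# * (x₀ * l + x₀ * l + w * l * l) + (q + - (w * l) * l)
          ≈⟨ +-cong (+-congˡ (*-congʳ (sym pw≈1))) (sym (schur-form N x)) ⟩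
        p * x₀ * x₀ + p * w * (x₀ * l + x₀ * l + w * l * l) + x ∙ (schur N $ x)
          ≈⟨ +-congʳ (solve 4 (λ p w x₀ l → p :* x₀ :* x₀ :+ p :* w :* (x₀ :* l :+ x₀ :* l :+ w :* l :* l)
               := p :* ((x₀ :+ w :* l) :* (x₀ :+ w :* l))) refl p w x₀ l) ⟩
        p * ((x₀ + w * l) * (x₀ + w * l)) + x ∙ (schur N $ x) ∎
        where
        open ≈-Reasoning
        l = r ∙ x
        q = x ∙ (minor N $ x)

      -- The first coordinate - (w (r ∙ x)) kills the square in `complete-square`, so every value of
      -- the Schur form is a value of the form of N.
      schur-psd : PositiveSemidefinite (schur N)
      schur-psd x = ≤-respʳ-≈
        (trans (complete-square (- (w * r ∙ x)) x)
          (solve 3 (λ p z q → p :* ((:- z :+ z) :* (:- z :+ z)) :+ q := q) refl p (w * r ∙ x) (x ∙ (schur N $ x))))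
        (N-psd (- (w * r ∙ x) ∷ᵛ x))

      -- A kernel vector is lifted by the same first coordinate: entry zero of the product becomes
      -- (1 - p w) l, and the other entries are those of the Schur complement.
      schur-singular : Singular (schur N) → Singular N
      schur-singular (x , x≉0 , Sx≈0) = y , (λ y≈0 → x≉0 (y≈0 ∘ suc)) , Ny≈0
        where
        l = r ∙ x
        y = - (w * l) ∷ᵛ x
        Ny≈0 : ∀ i → (N $ y) i ≈ 0#
        Ny≈0 zero = trans
          (solve 3 (λ p w l → p :* :- (w :* l) :+ l := (con (+ 1) :- p :* w) :* l) refl p w l)
          (trans (*-congʳ (trans (+-congˡ (-‿cong pw≈1)) (-‿inverseʳ 1#))) (zeroˡ l))
        Ny≈0 (suc i) = trans (+-congʳ (*-congʳ (N-sym (suc i) zero)))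
          (trans (solve 4 (λ r w l m → r :* :- (w :* l) :+ m := m :+ (:- (r :* w)) :* l) refl (r i) w l ((minor N $ x) i))
                 (trans (sym (schur-$ N x i)) (Sx≈0 i)))

      schur-coercive : Coercive (schur N) → Coercive N
      schur-coercive (K , 0≤K , bound) with L , 0≤L , L-bound ← ∙-bound r =
        w + w + C * K , +-nonNegative (+-nonNegative 0≤w 0≤w) (*-nonNegative 0≤C 0≤K) , coercive
        where
        -- As x₀ = y - w l, x₀² ≤ 2 y² + 2 w² l² ≤ 2 y² + 2 w² L s, which gives x ∙ x ≤ 2 y² + C s.
        -- Then 2 y² = 2 w (p y²) and s ≤ K S bound this by (2 w + C K) (p y² + S).
        C = w * w * (L + L) + 1#
        0≤C : 0# ≤ C
        0≤C = +-nonNegative (*-nonNegative (0≤x² w) (+-nonNegative 0≤L 0≤L)) 0≤1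
        coercive : ∀ x → x ∙ x ≤ (w + w + C * K) * x ∙ (N $ x)
        coercive x = begin
          x ∙ x
            ≤⟨ 0≤⇒≤ ((y + w * l) * (y + w * l) + w * w * (gap + gap))
                 (+-nonNegative (0≤x² _) (*-nonNegative (0≤x² w) (+-nonNegative 0≤gap 0≤gap)))
                 (solve 5 (λ x₀ w l s L → let y = x₀ :+ w :* l ; gap = L :* s :- l :* l in
                   x₀ :* x₀ :+ s :+ ((y :+ w :* l) :* (y :+ w :* l) :+ w :* w :* (gap :+ gap))
                   := con (+ 1) :* (y :* y :+ y :* y) :+ (w :* w :* (L :+ L) :+ con (+ 1)) :* s) refl x₀ w l s L) ⟩
          1# * (y * y + y * y) + C * s
            ≤⟨ +-monoʳ-≤ _ (*-monoˡ-≤ C 0≤C (bound x′)) ⟩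
          1# * (y * y + y * y) + C * (K * S)
            ≈⟨ +-congʳ (*-congʳ pw≈1) ⟨
          p * w * (y * y + y * y) + C * (K * S)
            ≤⟨ 0≤⇒≤ ((w + w) * S + C * K * (p * (y * y)))
                 (+-nonNegative (*-nonNegative (+-nonNegative 0≤w 0≤w) (schur-psd x′))
                                (*-nonNegative (*-nonNegative 0≤C 0≤K) (*-nonNegative 0≤p (0≤x² y))))
                 (solve 6 (λ p w y C K S → p :* w :* (y :* y :+ y :* y) :+ C :* (K :* S)
                            :+ ((w :+ w) :* S :+ C :* K :* (p :* (y :* y)))
                            := (w :+ w :+ C :* K) :* (p :* (y :* y) :+ S)) refl p w y C K S) ⟩
          (w + w + C * K) * (p * (y * y) + S)
            ≈⟨ *-congˡ (complete-square x₀ x′) ⟨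
          (w + w + C * K) * (x₀ ∷ᵛ x′) ∙ (N $ (x₀ ∷ᵛ x′)) ∎
          where
          open ≤-Reasoning
          x₀ = x zero
          x′ = x ∘ suc
          l = r ∙ x′
          s = x′ ∙ x′
          S = x′ ∙ (schur N $ x′)
          y = x₀ + w * l
          gap = L * s - l * l
          0≤gap : 0# ≤ gap
          0≤gap = ≤⇒0≤ (L-bound x′)

  psd⇒singular⊎coercive : ∀ {n} (N : Matrix {n}) → SymmetricMatrix N → PositiveSemidefinite N →
                          Singular N ⊎ Coercive N
  -- In dimension zero there is no nonzero vector, so the empty matrix is coercive, with K = 0.
  psd⇒singular⊎coercive {zero}  N N-sym N-psd = inj₂ (0# , ≤-refl , λ _ → ≤-reflexive (sym (zeroˡ 0#)))
  psd⇒singular⊎coercive {suc n} N N-sym N-psd = case N zero zero ≟ 0# of λ where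
    (yes p≈0) → inj₁ (p≈0⇒singular N N-sym N-psd p≈0)
    (no  p≉0) → Sum.map (schur-singular N N-sym N-psd p≉0) (schur-coercive N N-sym N-psd p≉0)
      (psd⇒singular⊎coercive (schur N) (schur-sym N N-sym N-psd p≉0) (schur-psd N N-sym N-psd p≉0))

  -- Rayleigh quotients and the eigenvalue at their supremum.

  form-bound : ∀ {n} (M : Matrix {n}) → ∃[ K ] (∀ x → x ∙ (M $ x) ≤ K * x ∙ x)
  form-bound {n} M = 1# + sum L , λ x → begin
    x ∙ (M $ x)
      ≤⟨ sum-mono-≤ (λ i → ≤-trans (x*y≤x²+y² (x i) ((M $ x) i))
                                   (+-monoʳ-≤ (x i * x i) (proj₂ (proj₂ (∙-bound (M i))) x))) ⟩
    sum (λ i → x i * x i + L i * x ∙ x)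
      ≈⟨ ∑-distrib-+ {n} _ _ ⟩
    x ∙ x + sum (λ i → L i * x ∙ x)
      ≈⟨ +-congˡ (*-distribʳ-sum {n} (x ∙ x) L) ⟨
    x ∙ x + sum L * x ∙ x
      ≈⟨ solve 2 (λ s l → s :+ l :* s := (con (+ 1) :+ l) :* s) refl (x ∙ x) (sum L) ⟩
    (1# + sum L) * x ∙ x ∎
    where
    open ≤-Reasoning
    L : Vector Carrier n
    L i = proj₁ (∙-bound (M i))

  -- The matrix s I - M, with the minus sign written as a scalar so that `sum-linear` applies.
  shift : ∀ {n} → Carrier → Matrix {n} → Matrix {n}
  shift s M i j = (if does (i Fin.≟ j) then s else 0#) + - 1# * M i j

  if-* : ∀ b x y → (if b then x else 0#) * y ≈ (if b then x * y else 0#)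
  if-* true  x y = refl
  if-* false x y = zeroˡ y

  shift-$ : ∀ {n} s (M : Matrix {n}) x i → (shift s M $ x) i ≈ s * x i - (M $ x) i
  shift-$ {n} s M x i = begin
    sum (λ j → ((if does (i Fin.≟ j) then s else 0#) + - 1# * M i j) * x j)
      ≈⟨ sum-cong-≋ {n} (λ j → trans (distribʳ _ _ _) (+-cong (if-* (does (i Fin.≟ j)) s (x j)) (*-assoc _ _ _))) ⟩
    sum (λ j → (if does (i Fin.≟ j) then s * x j else 0#) + - 1# * (M i j * x j))
      ≈⟨ sum-linear {n} _ _ (- 1#) ⟩
    sum (λ j → if does (i Fin.≟ j) then s * x j else 0#) + - 1# * (M $ x) i
      ≈⟨ +-cong (sum-δ i (λ j → s * x j)) (solve 1 (λ m → :- con (+ 1) :* m := :- m) refl ((M $ x) i)) ⟩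
    s * x i - (M $ x) i ∎
    where open ≈-Reasoning

  shift-form : ∀ {n} s (M : Matrix {n}) x → x ∙ (shift s M $ x) ≈ s * x ∙ x - x ∙ (M $ x)
  shift-form {n} s M x = begin
    sum (λ i → x i * (shift s M $ x) i)
      ≈⟨ sum-cong-≋ {n} (λ i → trans (*-congˡ (shift-$ s M x i))
           (solve 3 (λ x s m → x :* (s :* x :- m) := s :* (x :* x) :+ :- con (+ 1) :* (x :* m)) refl (x i) s ((M $ x) i))) ⟩
    sum (λ i → s * (x i * x i) + - 1# * (x i * (M $ x) i))
      ≈⟨ sum-linear {n} _ _ (- 1#) ⟩
    sum (λ i → s * (x i * x i)) + - 1# * x ∙ (M $ x)
      ≈⟨ +-cong (sym (*-distribˡ-sum {n} s _)) (solve 1 (λ m → :- con (+ 1) :* m := :- m) refl (x ∙ (M $ x))) ⟩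
    s * x ∙ x - x ∙ (M $ x) ∎
    where open ≈-Reasoning

  shift-sym : ∀ {n} s (M : Matrix {n}) → SymmetricMatrix M → SymmetricMatrix (shift s M)
  shift-sym s M M-sym i j = +-cong δ-sym (*-congˡ (M-sym i j))
    where
    δ-sym : (if does (i Fin.≟ j) then s else 0#) ≈ (if does (j Fin.≟ i) then s else 0#)
    δ-sym with i Fin.≟ j | j Fin.≟ i
    ... | yes _   | yes _   = refl
    ... | no  _   | no  _   = refl
    ... | yes i≡j | no  j≢i = contradiction (≡.sym i≡j) j≢i
    ... | no  i≢j | yes j≡i = contradiction (≡.sym j≡i) i≢j

  module _ {n} (M : Matrix {n}) (M-sym : SymmetricMatrix M) where

    -- The downward closure of the set of Rayleigh quotients: it has the same supremum and is stated
    -- without division.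
    RayleighBound : Pred Carrier 0ℓ
    RayleighBound t = ∃[ x ] (¬ x ∙ x ≈ 0# × t * x ∙ x ≤ x ∙ (M $ x))

    -- The supremum s of the Rayleigh quotients is an eigenvalue: s I − M is positive semidefinite,
    -- and were it coercive, s could be lowered.
    rayleigh⇒eigenvalue : ∀ c → RayleighBound c → ∃[ s ] (IsEigenvalue M s × c ≤ s)
    rayleigh⇒eigenvalue c c-bound = s ,
      Sum.[ eigenvector , (λ coercive → contradiction coercive ¬coercive) ]′
        (psd⇒singular⊎coercive N (shift-sym s M M-sym) N-psd) ,
      s-ub c c-bound
      where
      K = proj₁ (form-bound M)

      K-ub : UpperBound RayleighBound K
      K-ub t (x , X≉0 , tX≤Q) = *-cancelʳ-≤ (0≤x∙x x) X≉0 (≤-trans tX≤Q (proj₂ (form-bound M) x))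

      supremum = complete RayleighBound (c , c-bound) (K , K-ub)
      s = proj₁ supremum
      N = shift s M

      s-ub : UpperBound RayleighBound s
      s-ub = proj₁ (proj₂ supremum)

      form≤ : ∀ x → x ∙ (M $ x) ≤ s * x ∙ x
      form≤ x with x ∙ x ≟ 0#
      ... | yes X≈0 = ≤-reflexive (trans (sum-zero {n} (λ i → trans (*-congʳ (x∙x≈0⇒x≈0 x X≈0 i)) (zeroˡ _)))
                                         (sym (trans (*-congˡ X≈0) (zeroʳ s))))
      ... | no  X≉0 = begin
        Q               ≈⟨ [QX⁻¹]X≈Q ⟨
        Q * X ⁻¹ * X    ≤⟨ *-monoʳ-≤ X (0≤x∙x x) (s-ub (Q * X ⁻¹) (x , X≉0 , ≤-reflexive [QX⁻¹]X≈Q)) ⟩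
        s * X           ∎
        where
        open ≤-Reasoning
        X = x ∙ x
        Q = x ∙ (M $ x)
        [QX⁻¹]X≈Q : Q * X ⁻¹ * X ≈ Q
        [QX⁻¹]X≈Q = trans (*-assoc _ _ _) (trans (*-congˡ (trans (*-comm _ _) (⁻¹-inverseʳ X X≉0))) (*-identityʳ Q))

      N-psd : PositiveSemidefinite N
      N-psd x = ≤-respʳ-≈ (sym (shift-form s M x)) (≤⇒0≤ (form≤ x))

      eigenvector : Singular N → IsEigenvalue M s
      eigenvector (x , x≉0 , Nx≈0) = x , x≉0 , λ i → begin
        (M $ x) i                             ≈⟨ solve 2 (λ m z → m := z :- (z :- m)) refl ((M $ x) i) (s * x i) ⟩
        s * x i - (s * x i - (M $ x) i)       ≈⟨ +-congˡ (-‿cong (trans (sym (shift-$ s M x i)) (Nx≈0 i))) ⟩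
        s * x i - 0#                          ≈⟨ solve 1 (λ z → z :- con (+ 0) := z) refl (s * x i) ⟩
        s * x i                               ∎
        where open ≈-Reasoning

      ¬coercive : ¬ Coercive N
      ¬coercive (K , 0≤K , bound) = 0≉1 (sym 1≈0)
        where
        open ≤-Reasoning
        -- K may be zero, but K + 1 is invertible. With ε = 1 / (K + 1), coercivity gives ε X ≤ ε K
        -- F ≤ F = s X - Q, so s - ε would still be an upper bound.
        K′ = K + 1#
        K′≉0 : ¬ K′ ≈ 0#
        K′≉0 K′≈0 = 0≰-1 (≤-respʳ-≈ (trans (solve 1 (λ k → k := k :+ con (+ 1) :- con (+ 1)) refl K)
                            (trans (+-congʳ K′≈0) (+-identityˡ _))) 0≤K)
        ε = K′ ⁻¹
        0≤ε : 0# ≤ ε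
        0≤ε = 0≤x⁻¹ (+-nonNegative 0≤K 0≤1) K′≉0
        lower-ub : UpperBound RayleighBound (s - ε)
        lower-ub t (x , X≉0 , tX≤Q) = 0≤⇒≤ (s - (t + ε)) (≤⇒0≤ (*-cancelʳ-≤ (0≤x∙x x) X≉0 (begin
          (t + ε) * X             ≈⟨ distribʳ _ _ _ ⟩
          t * X + ε * X           ≤⟨ +-mono-≤ tX≤Q (*-monoˡ-≤ ε 0≤ε (bound x)) ⟩
          Q + ε * (K * F)         ≤⟨ 0≤⇒≤ (ε * F) (*-nonNegative 0≤ε (N-psd x))
                                       (solve 4 (λ q e k f → q :+ e :* (k :* f) :+ e :* f
                                                          := q :+ (k :+ con (+ 1)) :* e :* f) refl Q ε K F) ⟩
          Q + K′ * ε * F          ≈⟨ +-congˡ (*-cong (⁻¹-inverseʳ K′ K′≉0) (shift-form s M x)) ⟩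
          Q + 1# * (s * X - Q)    ≈⟨ solve 2 (λ q z → q :+ con (+ 1) :* (z :- q) := z) refl Q (s * X) ⟩
          s * X                   ∎)))
          (solve 3 (λ t s e → t :+ (s :- (t :+ e)) := s :- e) refl t s ε)
          where
          X = x ∙ x
          Q = x ∙ (M $ x)
          F = x ∙ (N $ x)
        ε≤0 : ε ≤ 0#
        ε≤0 = 0≤⇒≤ (s - ε - s) (≤⇒0≤ (proj₂ (proj₂ supremum) (s - ε) lower-ub))
                (solve 2 (λ s e → e :+ (s :- e :- s) := con (+ 0)) refl s ε)
        1≈0 : 1# ≈ 0#
        1≈0 = begin-equality
          1#        ≈⟨ ⁻¹-inverseʳ K′ K′≉0 ⟨
          K′ * ε    ≈⟨ *-congˡ (antisym ε≤0 0≤ε) ⟩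
          K′ * 0#   ≈⟨ zeroʳ K′ ⟩
          0#        ∎

-- The fractional matching number through the bipartite double cover.

module FractionalMatching (ℝ : CompleteOrderedField) where

  open import Data.Integer.Base using (+_)
  open CompleteOrderedField ℝ hiding (zero)
  open RealGraphTheory ℝ
  open IntegerCoefficients commutativeRing using (module Solver)
  open Solver
  open import Algebra.Properties.Semiring.Sum semiring
    using (sum-cong-≋; sum-replicate-zero; ∑-distrib-+; ∑-comm; *-distribˡ-sum; *-distribʳ-sum)
  open import Algebra.Properties.Semiring.Mult semiring using (×-homo-+)
  open OrderedField ℝ
  open QuadraticForms ℝ
  open BipartiteMatching
  open FiniteSums +-commutativeMonoid
  import Algebra.Properties.CommutativeMonoid.Sum ℕ.+-0-commutativeMonoid as ℕΣ

  fromℕ-+ : ∀ l m → fromℕ (l ℕ.+ m) ≈ fromℕ l + fromℕ m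
  fromℕ-+ = ×-homo-+ 1#

  fromℕ-mono-≤ : ∀ {l m} → l ℕ.≤ m → fromℕ l ≤ fromℕ m
  fromℕ-mono-≤ {l} {m} l≤m = 0≤⇒≤ (fromℕ (m ℕ.∸ l)) (0≤fromℕ (m ℕ.∸ l))
    (trans (sym (fromℕ-+ l (m ℕ.∸ l))) (reflexive (≡.cong fromℕ (ℕ.m+[n∸m]≡n l≤m))))

  fromℕ-sum : ∀ {n} (f : Fin n → ℕ) → fromℕ (ℕΣ.sum f) ≈ sum (fromℕ ∘ f)
  fromℕ-sum {zero}  f = refl
  fromℕ-sum {suc n} f = trans (fromℕ-+ (f zero) _) (+-congˡ (fromℕ-sum (f ∘ suc)))

  χ : Bool → Carrier
  χ b = if b then 1# else 0#

  0≤χ : ∀ b → 0# ≤ χ b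
  0≤χ true  = 0≤1
  0≤χ false = ≤-refl

  fromℕ-𝟙 : ∀ b → fromℕ (𝟙 b) ≈ χ b
  fromℕ-𝟙 true  = +-identityʳ 1#
  fromℕ-𝟙 false = refl

  fromℕ-count : ∀ {n} (A : Fin n → Bool) → fromℕ (count A) ≈ sum (χ ∘ A)
  fromℕ-count {n} A = trans (fromℕ-sum (𝟙 ∘ A)) (sum-cong-≋ {n} (fromℕ-𝟙 ∘ A))

  fromℕ1≈1 : fromℕ 1 ≈ 1#
  fromℕ1≈1 = +-identityʳ 1#

  fromℕ2≈1+1 : fromℕ 2 ≈ 1# + 1#
  fromℕ2≈1+1 = +-congˡ (+-identityʳ 1#)

  fromℕ2≉0 : ¬ fromℕ 2 ≈ 0#
  fromℕ2≉0 2≈0 = 0≉1 (antisym 0≤1 (≤-respʳ-≈ (trans (sym fromℕ2≈1+1) 2≈0) (0≤⇒≤ 1# 0≤1 refl)))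

  ½ : Carrier
  ½ = fromℕ 2 ⁻¹

  ½+½≈1 : ½ + ½ ≈ 1#
  ½+½≈1 = trans (trans (solve 1 (λ h → h :+ h := con (+ 2) :* h) refl ½) (*-congʳ (sym fromℕ2≈1+1)))
                (⁻¹-inverseʳ (fromℕ 2) fromℕ2≉0)

  0≤½ : 0# ≤ ½
  0≤½ = 0≤x⁻¹ (0≤fromℕ 2) fromℕ2≉0

  ½≉0 : ¬ ½ ≈ 0#
  ½≉0 ½≈0 = 0≉1 (trans (sym (trans (+-cong ½≈0 ½≈0) (+-identityˡ 0#))) ½+½≈1)

  halve : ∀ {x y} → x + x ≈ y → x ≈ y * ½
  halve {x} {y} x+x≈y = begin
    x               ≈⟨ *-identityʳ x ⟨
    x * 1#          ≈⟨ *-congˡ ½+½≈1 ⟨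
    x * (½ + ½)     ≈⟨ solve 2 (λ x h → x :* (h :+ h) := (x :+ x) :* h) refl x ½ ⟩
    (x + x) * ½     ≈⟨ *-congʳ x+x≈y ⟩
    y * ½           ∎
    where open ≈-Reasoning

  halve-≤ : ∀ {x y} → x + x ≤ y → x ≤ y * ½
  halve-≤ 2x≤y = ≤-respˡ-≈ (sym (halve refl)) (*-monoʳ-≤ ½ 0≤½ 2x≤y)

  module _ {n} (G : Graph n) where

    -- The edge list holds each edge in increasing order only, while the double sum meets both
    -- orientations.
    edge-sum : (φ : Fin n × Fin n → Carrier) →
               (∀ u v → φ (u , v) ≈ φ (v , u)) → (∀ u v → ¬ Adj G u v → φ (u , v) ≈ 0#) →
               sum (φ ∘ endpoints G) + sum (φ ∘ endpoints G) ≈ ∑[ u < n ] ∑[ v < n ] φ (u , v)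
    edge-sum φ φ-sym φ-support = begin
      sum (φ ∘ endpoints G) + sum (φ ∘ endpoints G)
        ≈⟨ +-cong (sum-allPairs-filter edge? φ) (trans (sum-allPairs-filter edge? φ) (∑-comm {n} {n} _)) ⟩
      ∑[ u < n ] ∑[ v < n ] ψ u v + ∑[ u < n ] ∑[ v < n ] ψ v u
        ≈⟨ ∑-distrib-+ {n} _ _ ⟨
      ∑[ u < n ] (∑[ v < n ] ψ u v + ∑[ v < n ] ψ v u)
        ≈⟨ sum-cong-≋ {n} (λ u → trans (sym (∑-distrib-+ {n} _ _)) (sum-cong-≋ {n} (ψ-symmetrise u))) ⟩
      ∑[ u < n ] ∑[ v < n ] φ (u , v) ∎
      where
      open ≈-Reasoning

      edge? : ∀ uv → Dec (proj₁ uv Fin.< proj₂ uv × Adj G (proj₁ uv) (proj₂ uv))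
      edge? (u , v) = (u Fin.<? v) ×-dec adj? G u v

      ψ : Fin n → Fin n → Carrier
      ψ u v = if does (edge? (u , v)) then φ (u , v) else 0#

      ψ-yes : ∀ {u v} → u Fin.< v → Adj G u v → ψ u v ≈ φ (u , v)
      ψ-yes {u} {v} u<v uv = reflexive (≡.cong (λ b → if b then φ (u , v) else 0#) (dec-true (edge? (u , v)) (u<v , uv)))

      ψ-no : ∀ {u v} → ¬ (u Fin.< v × Adj G u v) → ψ u v ≈ 0#
      ψ-no {u} {v} ¬uv = reflexive (≡.cong (λ b → if b then φ (u , v) else 0#) (dec-false (edge? (u , v)) ¬uv))

      ψ-symmetrise : ∀ u v → ψ u v + ψ v u ≈ φ (u , v)
      ψ-symmetrise u v = case adj? G u v of λ where
        (no ¬uv) → trans (+-cong (ψ-no (¬uv ∘ proj₂)) (ψ-no (¬uv ∘ adj-sym G ∘ proj₂)))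
                         (trans (+-identityˡ 0#) (sym (φ-support u v ¬uv)))
        (yes uv) → case Fin.<-cmp u v of λ where
          (tri< u<v _ v≮u) → trans (+-cong (ψ-yes u<v uv) (ψ-no (v≮u ∘ proj₁))) (+-identityʳ _)
          (tri≈ _ u≡v _)   → contradiction uv (adj-irrefl G u≡v)
          (tri> u≮v _ v<u) → trans (+-cong (ψ-no (u≮v ∘ proj₁)) (ψ-yes v<u (adj-sym G uv)))
                                   (trans (+-identityˡ _) (φ-sym v u))

    -- Edges of the bipartite double cover of G.
    arcs : List (Fin n × Fin n)
    arcs = filter (λ uv → adj? G (proj₁ uv) (proj₂ uv)) (cartesianProduct (allFin n) (allFin n))

    ∈-arcs⁺ : ∀ {u v} → Adj G u v → (u , v) ∈ arcs
    ∈-arcs⁺ {u} {v} = ∈-filter⁺ (λ uv → adj? G (proj₁ uv) (proj₂ uv)) (∈-cartesianProduct⁺ (∈-allFin u) (∈-allFin v))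

    ∈-arcs⁻ : ∀ {u v} → (u , v) ∈ arcs → Adj G u v
    ∈-arcs⁻ uv∈ = proj₂ (∈-filter⁻ (λ uv → adj? G (proj₁ uv) (proj₂ uv)) {xs = cartesianProduct (allFin n) (allFin n)} uv∈)

    endpoints-edge : ∀ e → let u , v = endpoints G e in u Fin.< v × Adj G u v
    endpoints-edge e = proj₂ (∈-filter⁻ (λ uv → (proj₁ uv Fin.<? proj₂ uv) ×-dec adj? G (proj₁ uv) (proj₂ uv))
                                {xs = cartesianProduct (allFin n) (allFin n)} (∈-lookup e))

    module _ {A B : Fin n → Bool} (cover : IsCover arcs A B) where

      -- Twice a fractional vertex cover, with values 0, 1 and 2; the halving is postponed to the
      -- final comparison.
      cover-weight : Fin n → Carrier
      cover-weight v = χ (A v) + χ (B v)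

      private
        y = cover-weight

      1≤χA+χB : ∀ {u v} → Adj G u v → 1# ≤ χ (A u) + χ (B v)
      1≤χA+χB {u} {v} uv with A u | B v | cover (∈-arcs⁺ uv)
      ... | true  | b    | _ = 0≤⇒≤ (χ b) (0≤χ b) refl
      ... | false | true | _ = ≤-reflexive (sym (+-identityˡ 1#))
      ... | false | false | inj₁ ()
      ... | false | false | inj₂ ()

      -- Both orientations of an edge are arcs, and covering each of them contributes 1.
      2≤y+y : ∀ {u v} → Adj G u v → 1# + 1# ≤ y u + y v
      2≤y+y {u} {v} uv = ≤-respʳ-≈
        (solve 4 (λ a b c d → a :+ b :+ (c :+ d) := a :+ d :+ (c :+ b)) refl (χ (A u)) (χ (B v)) (χ (A v)) (χ (B u)))
        (+-mono-≤ (1≤χA+χB uv) (1≤χA+χB (adj-sym G uv)))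

      -- Weak duality by double counting: 2 f(e) is charged to the endpoints of e, whose weights add
      -- up to at least 2; collected at v, the charge is at most the weight of v.
      matching≤cover : ∀ f → IsFractionalMatching G f → sum f + sum f ≤ sum y
      matching≤cover f (f-bounds , f-vertex) = begin
        sum f + sum f
          ≈⟨ ∑-distrib-+ {m} f f ⟨
        ∑[ e < m ] (f e + f e)
          ≤⟨ sum-mono-≤ {m} edge-bound ⟩
        ∑[ e < m ] ∑[ v < n ] (y v * at v e)
          ≈⟨ ∑-comm {m} {n} _ ⟩
        ∑[ v < n ] ∑[ e < m ] (y v * at v e)
          ≈⟨ sum-cong-≋ {n} (λ v → *-distribˡ-sum {m} (y v) (at v)) ⟨
        ∑[ v < n ] (y v * sum (at v))
          ≤⟨ sum-mono-≤ {n} (λ v → *-monoˡ-≤ (y v) (+-nonNegative (0≤χ (A v)) (0≤χ (B v))) (f-vertex v)) ⟩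
        ∑[ v < n ] (y v * 1#)
          ≈⟨ sum-cong-≋ {n} (λ v → *-identityʳ (y v)) ⟩
        sum y ∎
        where
        open ≤-Reasoning
        m = length (edges G)
        at : Fin n → Edge G → Carrier
        at v e = if does (incident? G v e) then f e else 0#
        edge-bound : ∀ e → f e + f e ≤ ∑[ v < n ] (y v * at v e)
        edge-bound e = begin
          f e + f e
            ≈⟨ solve 1 (λ f → f :+ f := con (+ 2) :* f) refl (f e) ⟩
          (1# + 1#) * f e
            ≤⟨ *-monoʳ-≤ (f e) (proj₁ (f-bounds e)) (2≤y+y (proj₂ (endpoints-edge e))) ⟩
          (y u + y v) * f e
            ≈⟨ distribʳ (f e) (y u) (y v) ⟩
          y u * f e + y v * f e
            ≈⟨ +-cong (sum-δ′ u (λ w → y w * f e)) (sum-δ′ v (λ w → y w * f e)) ⟨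
          ∑[ w < n ] (if does (w Fin.≟ u) then y w * f e else 0#)
            + ∑[ w < n ] (if does (w Fin.≟ v) then y w * f e else 0#)
            ≈⟨ ∑-distrib-+ {n} _ _ ⟨
          ∑[ w < n ] ((if does (w Fin.≟ u) then y w * f e else 0#) + (if does (w Fin.≟ v) then y w * f e else 0#))
            ≈⟨ sum-cong-≋ {n} pointwise ⟩
          ∑[ w < n ] (y w * at w e) ∎
          where
          u = proj₁ (endpoints G e)
          v = proj₂ (endpoints G e)
          pointwise : ∀ w → (if does (w Fin.≟ u) then y w * f e else 0#) + (if does (w Fin.≟ v) then y w * f e else 0#)
                            ≈ y w * at w e
          pointwise w with w Fin.≟ u | w Fin.≟ v
          ... | yes w≡u | yes w≡v = contradiction (≡.trans (≡.sym w≡u) w≡v) (Fin.<⇒≢ (proj₁ (endpoints-edge e)))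
          ... | yes _   | no  _   = +-identityʳ _
          ... | no  _   | yes _   = +-identityˡ _
          ... | no  _   | no  _   = trans (+-identityˡ 0#) (sym (zeroʳ (y w)))

    module _ {M : Fin n → Fin n → ℕ} (matching : IsMatching arcs M) where

      open IsMatching matching

      private
        m : Fin n → Fin n → Carrier
        m u v = fromℕ (M u v)

        W = fromℕ (size M)

        φ : Fin n × Fin n → Carrier
        φ (u , v) = m u v + m v u

        m-row≤1 : ∀ u → sum (m u) ≤ 1#
        m-row≤1 u = ≤-respʳ-≈ fromℕ1≈1 (≤-respˡ-≈ (fromℕ-sum (M u)) (fromℕ-mono-≤ (row≤1 u)))

        m-column≤1 : ∀ v → ∑[ u < n ] m u v ≤ 1#
        m-column≤1 v = ≤-respʳ-≈ fromℕ1≈1 (≤-respˡ-≈ (fromℕ-sum (λ u → M u v)) (fromℕ-mono-≤ (column≤1 v)))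

        m≤1 : ∀ u v → m u v ≤ 1#
        m≤1 u v = ≤-trans (term≤sum (λ v → 0≤fromℕ (M u v)) v) (m-row≤1 u)

        Σm≈W : ∑[ u < n ] ∑[ v < n ] m u v ≈ W
        Σm≈W = sym (trans (fromℕ-sum (λ u → ℕΣ.sum (M u))) (sum-cong-≋ {n} (λ u → fromℕ-sum (M u))))

        φ-sym : ∀ u v → φ (u , v) ≈ φ (v , u)
        φ-sym u v = +-comm _ _

        φ-support : ∀ u v → ¬ Adj G u v → φ (u , v) ≈ 0#
        φ-support u v ¬uv = trans
          (+-cong (reflexive (≡.cong fromℕ (support u v (¬uv ∘ ∈-arcs⁻))))
                  (reflexive (≡.cong fromℕ (support v u (¬uv ∘ adj-sym G ∘ ∈-arcs⁻)))))
          (+-identityˡ 0#)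

        0≤φ : ∀ u v → 0# ≤ φ (u , v)
        0≤φ u v = +-nonNegative (0≤fromℕ (M u v)) (0≤fromℕ (M v u))

        Σφ-row≤2 : ∀ u → ∑[ v < n ] φ (u , v) ≤ 1# + 1#
        Σφ-row≤2 u = ≤-respˡ-≈ (sym (∑-distrib-+ {n} _ _)) (+-mono-≤ (m-row≤1 u) (m-column≤1 u))

      symmetrised : Edge G → Carrier
      symmetrised e = φ (endpoints G e) * ½

      private
        2≤⇒½≤1 : ∀ {x} → x ≤ 1# + 1# → x * ½ ≤ 1#
        2≤⇒½≤1 {x} x≤2 = begin
          x * ½           ≤⟨ *-monoʳ-≤ ½ 0≤½ x≤2 ⟩
          (1# + 1#) * ½   ≈⟨ solve 1 (λ h → con (+ 2) :* h := h :+ h) refl ½ ⟩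
          ½ + ½           ≈⟨ ½+½≈1 ⟩
          1#              ∎
          where open ≤-Reasoning

        vertex-bound : ∀ w → sum (λ e → if does (incident? G w e) then symmetrised e else 0#) ≤ 1#
        vertex-bound w = begin
          sum (λ e → if does (incident? G w e) then φ (endpoints G e) * ½ else 0#)
            ≈⟨ sum-cong-≋ {length (edges G)} (λ e → sym (if-* (does (incident? G w e)) (φ (endpoints G e)) ½)) ⟩
          sum (λ e → ψ (endpoints G e) * ½)
            ≈⟨ *-distribʳ-sum {length (edges G)} ½ (ψ ∘ endpoints G) ⟨
          sum (ψ ∘ endpoints G) * ½
            ≤⟨ 2≤⇒½≤1 Σψ≤2 ⟩
          1# ∎
          where
          open ≤-Reasoning
          -- At the endpoints of e this is by definition the boolean of `incident? G w e`. As a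
          -- function of pairs it is symmetric, which brings the sum within reach of `edge-sum`.
          meets : Fin n → Fin n → Bool
          meets u v = does (w Fin.≟ u) ∨ does (w Fin.≟ v)
          ψ : Fin n × Fin n → Carrier
          ψ (u , v) = if meets u v then φ (u , v) else 0#
          meets-comm : ∀ u v → meets u v ≡ meets v u
          meets-comm u v with does (w Fin.≟ u) | does (w Fin.≟ v)
          ... | true  | true  = ≡.refl
          ... | true  | false = ≡.refl
          ... | false | true  = ≡.refl
          ... | false | false = ≡.refl
          ψ-sym : ∀ u v → ψ (u , v) ≈ ψ (v , u)
          ψ-sym u v rewrite meets-comm u v with meets v u
          ... | true  = φ-sym u v
          ... | false = refl
          ψ-support : ∀ u v → ¬ Adj G u v → ψ (u , v) ≈ 0#
          ψ-support u v ¬uv with meets u v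
          ... | true  = φ-support u v ¬uv
          ... | false = refl
          -- The pairs through w form row w and column w of φ, which overlap only at (w , w). By
          -- symmetry the two lines have equal sums, so halving leaves one row sum of φ, that is,
          -- row w plus column w of M.
          ψ≤ : ∀ u v → ψ (u , v) ≤ (if does (w Fin.≟ u) then φ (u , v) else 0#)
                                   + (if does (w Fin.≟ v) then φ (u , v) else 0#)
          ψ≤ u v with does (w Fin.≟ u) | does (w Fin.≟ v)
          ... | true  | true  = 0≤⇒≤ _ (0≤φ u v) refl
          ... | true  | false = ≤-reflexive (sym (+-identityʳ _))
          ... | false | true  = ≤-reflexive (sym (+-identityˡ _))
          ... | false | false = ≤-reflexive (sym (+-identityˡ _))
          Σ-if : ∀ b (f : Fin n → Carrier) → ∑[ v < n ] (if b then f v else 0#) ≈ (if b then sum f else 0#)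
          Σ-if true  f = refl
          Σ-if false f = sum-replicate-zero n
          ΣΣψ≤ : ∑[ u < n ] ∑[ v < n ] ψ (u , v) ≤ ∑[ v < n ] φ (w , v) + ∑[ v < n ] φ (w , v)
          ΣΣψ≤ = begin
            ∑[ u < n ] ∑[ v < n ] ψ (u , v)
              ≤⟨ sum-mono-≤ {n} (λ u → sum-mono-≤ {n} (ψ≤ u)) ⟩
            ∑[ u < n ] ∑[ v < n ] ((if does (w Fin.≟ u) then φ (u , v) else 0#)
                                   + (if does (w Fin.≟ v) then φ (u , v) else 0#))
              ≈⟨ sum-cong-≋ {n} (λ u → trans (∑-distrib-+ {n} _ _)
                   (+-cong (Σ-if (does (w Fin.≟ u)) (λ v → φ (u , v))) (sum-δ w (λ v → φ (u , v))))) ⟩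
            ∑[ u < n ] ((if does (w Fin.≟ u) then ∑[ v < n ] φ (u , v) else 0#) + φ (u , w))
              ≈⟨ ∑-distrib-+ {n} _ _ ⟩
            ∑[ u < n ] (if does (w Fin.≟ u) then ∑[ v < n ] φ (u , v) else 0#) + ∑[ u < n ] φ (u , w)
              ≈⟨ +-cong (sum-δ w (λ u → ∑[ v < n ] φ (u , v))) (sum-cong-≋ {n} (λ u → φ-sym u w)) ⟩
            ∑[ v < n ] φ (w , v) + ∑[ v < n ] φ (w , v) ∎
          Σψ≤2 : sum (ψ ∘ endpoints G) ≤ 1# + 1#
          Σψ≤2 = begin
            sum (ψ ∘ endpoints G)
              ≤⟨ halve-≤ (≤-respˡ-≈ (sym (edge-sum ψ ψ-sym ψ-support)) ΣΣψ≤) ⟩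
            (∑[ v < n ] φ (w , v) + ∑[ v < n ] φ (w , v)) * ½
              ≈⟨ halve refl ⟨
            ∑[ v < n ] φ (w , v)
              ≤⟨ Σφ-row≤2 w ⟩
            1# + 1# ∎

      symmetrised-matching : IsFractionalMatching G symmetrised
      symmetrised-matching =
        (λ e → *-nonNegative (0≤φ _ _) 0≤½ , 2≤⇒½≤1 (+-mono-≤ (m≤1 _ _) (m≤1 _ _))) , vertex-bound

      sum-symmetrised : sum symmetrised ≈ W * ½
      sum-symmetrised = begin
        sum symmetrised                       ≈⟨ *-distribʳ-sum {length (edges G)} ½ (φ ∘ endpoints G) ⟨
        sum (φ ∘ endpoints G) * ½             ≈⟨ *-congʳ Σφ≈W ⟩
        W * ½                                 ∎
        where
        open ≈-Reasoning
        Σφ≈W : sum (φ ∘ endpoints G) ≈ W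
        Σφ≈W = begin
          sum (φ ∘ endpoints G)                         ≈⟨ halve (edge-sum φ φ-sym φ-support) ⟩
          ∑[ u < n ] ∑[ v < n ] φ (u , v) * ½
            ≈⟨ *-congʳ (trans (sum-cong-≋ {n} (λ u → ∑-distrib-+ {n} _ _)) (∑-distrib-+ {n} _ _)) ⟩
          (∑[ u < n ] ∑[ v < n ] m u v + ∑[ u < n ] ∑[ v < n ] m v u) * ½
            ≈⟨ *-congʳ (+-cong Σm≈W (trans (∑-comm {n} {n} _) Σm≈W)) ⟩
          (W + W) * ½                                   ≈⟨ halve refl ⟨
          W                                             ∎

    module _ (pair : TightPair arcs) where

      open TightPair pair

      cover-weight≤size : sum (cover-weight cover) ≤ fromℕ (size M)
      cover-weight≤size = begin
        sum (cover-weight cover)              ≈⟨ ∑-distrib-+ {n} _ _ ⟩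
        sum (χ ∘ A) + sum (χ ∘ B)             ≈⟨ +-cong (fromℕ-count A) (fromℕ-count B) ⟨
        fromℕ (count A) + fromℕ (count B)     ≈⟨ fromℕ-+ (count A) (count B) ⟨
        fromℕ (count A ℕ.+ count B)           ≤⟨ fromℕ-mono-≤ tight ⟩
        fromℕ (size M)                        ∎
        where open ≤-Reasoning

      fractionalMatchingNumber : IsFractionalMatchingNumber G (fromℕ (size M) / fromℕ 2)
      fractionalMatchingNumber =
        (symmetrised matching , symmetrised-matching matching , sym (sum-symmetrised matching)) ,
        λ w (f , f-matching , w≈Σf) → ≤-respˡ-≈ (sym w≈Σf)
          (halve-≤ (≤-trans (matching≤cover cover f f-matching) cover-weight≤size))

-- Cliques and the spectrum of a D + A.

module ComplementSpectrum (ℝ : CompleteOrderedField) where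

  open import Data.Integer.Base using (+_)
  open CompleteOrderedField ℝ hiding (zero)
  open RealGraphTheory ℝ
  open IntegerCoefficients commutativeRing using (module Solver)
  open Solver
  open import Algebra.Properties.Semiring.Sum semiring
    using (sum-cong-≋; sum-replicate; ∑-distrib-+; *-distribˡ-sum)
  open OrderedField ℝ
  open QuadraticForms ℝ
  open BipartiteMatching
  open FractionalMatching ℝ
  open FiniteSums +-commutativeMonoid

  fromℕ-degree : ∀ {n} (H : Graph n) v → fromℕ (degree H v) ≈ ∑[ u < n ] χ (does (adj? H v u))
  fromℕ-degree {n} H v = trans (sym (sum-replicate (degree H v))) (sum-allFin-filter (adj? H v) (λ _ → 1#))

  minDegree≤degree : ∀ {n} (H : Graph n) v → minDegree H ℕ.≤ degree H v
  minDegree≤degree {n} H v = All.lookup (min≤xs n (List.map (degree H) (allFin n))) (∈-map⁺ (degree H) (∈-allFin v))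

  aD+A-sym : ∀ a {n} (H : Graph n) → SymmetricMatrix (aD+A a H)
  aD+A-sym a H i j = +-cong (*-congˡ D-sym) A-sym
    where
    D-sym : degreeMatrix H i j ≈ degreeMatrix H j i
    D-sym with i Fin.≟ j | j Fin.≟ i
    ... | yes i≡j | yes _   = reflexive (≡.cong (fromℕ ∘ degree H) i≡j)
    ... | no  _   | no  _   = refl
    ... | yes i≡j | no  j≢i = contradiction (≡.sym i≡j) j≢i
    ... | no  i≢j | yes j≡i = contradiction (≡.sym j≡i) i≢j
    A-sym : adjacencyMatrix H i j ≈ adjacencyMatrix H j i
    A-sym with adj? H i j | adj? H j i
    ... | yes _  | yes _  = refl
    ... | no  _  | no  _  = refl
    ... | yes ij | no ¬ji = contradiction (adj-sym H ij) ¬ji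
    ... | no ¬ij | yes ji = contradiction (adj-sym H ji) ¬ij

  aD+A-$ : ∀ a {n} (H : Graph n) x i →
    (aD+A a H $ x) i ≈ a * (fromℕ (degree H i) * x i) + ∑[ j < n ] (adjacencyMatrix H i j * x j)
  aD+A-$ a {n} H x i = begin
    ∑[ j < n ] ((a * degreeMatrix H i j + adjacencyMatrix H i j) * x j)
      ≈⟨ sum-cong-≋ {n} (λ j → trans (solve 4 (λ a d m x → (a :* d :+ m) :* x := m :* x :+ a :* (d :* x)) refl
                                       a (degreeMatrix H i j) (adjacencyMatrix H i j) (x j))
                                     (+-congˡ (*-congˡ (if-* (does (i Fin.≟ j)) (fromℕ (degree H i)) (x j))))) ⟩
    ∑[ j < n ] (adjacencyMatrix H i j * x j + a * (if does (i Fin.≟ j) then fromℕ (degree H i) * x j else 0#))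
      ≈⟨ sum-linear {n} _ _ a ⟩
    ∑[ j < n ] (adjacencyMatrix H i j * x j) + a * ∑[ j < n ] (if does (i Fin.≟ j) then fromℕ (degree H i) * x j else 0#)
      ≈⟨ trans (+-congˡ (*-congˡ (sum-δ i (λ j → fromℕ (degree H i) * x j)))) (+-comm _ _) ⟩
    a * (fromℕ (degree H i) * x i) + ∑[ j < n ] (adjacencyMatrix H i j * x j) ∎
    where open ≈-Reasoning

  -- The test vector is the indicator of the clique.
  clique⇒eigenvalue : ∀ {a} → 0# ≤ a → ∀ {n} (H : Graph n) (I : Fin n → Bool) →
    (∀ {i j} → I i ≡ true → I j ≡ true → i ≢ j → Adj H i j) → ∀ v → I v ≡ true →
    ∃[ s ] (IsEigenvalue (aD+A a H) s × (a + 1#) * (sum (χ ∘ I) - 1#) ≤ s)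
  clique⇒eigenvalue {a} 0≤a {n} H I clique v Iv =
    rayleigh⇒eigenvalue (aD+A a H) (aD+A-sym a H) c (x , x∙x≉0 , c-bound)
    where
    open ≤-Reasoning
    x : Vector Carrier n
    x = χ ∘ I
    c = (a + 1#) * (sum x - 1#)

    x∙x≉0 : ¬ x ∙ x ≈ 0#
    x∙x≉0 x∙x≈0 = 0≉1 (trans (sym (x∙x≈0⇒x≈0 x x∙x≈0 v)) (reflexive (≡.cong χ Iv)))

    e : Fin n → Fin n → Carrier
    e i j = χ (does (i Fin.≟ j))

    χ-adj : ∀ {i j} → I i ≡ true → I j ≡ true → i ≢ j → adjacencyMatrix H i j ≈ 1#
    χ-adj {i} {j} Ii Ij i≢j = reflexive (≡.cong χ (dec-true (adj? H i j) (clique Ii Ij i≢j)))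

    -- On a clique row, adjacency matrix plus identity has an entry at least 1 at every clique
    -- vertex. The identity contributes the 1 that is subtracted in c.
    x≤A+e : ∀ i → I i ≡ true → ∀ j → x j ≤ adjacencyMatrix H i j * x j + e i j
    x≤A+e i Ii j with I j in Ij
    ... | false = ≤-respˡ-≈ (+-identityˡ 0#) (+-mono-≤ (≤-reflexive (sym (zeroʳ _))) (0≤χ (does (i Fin.≟ j))))
    ... | true  = case i Fin.≟ j of λ where
      (yes i≡j) → ≤-respˡ-≈ (+-identityˡ 1#) (+-mono-≤
        (≤-respʳ-≈ (sym (*-identityʳ _)) (0≤χ (does (adj? H i j))))
        (≤-reflexive (reflexive (≡.sym (≡.cong χ (dec-true (i Fin.≟ j) i≡j))))))
      (no  i≢j) → ≤-respˡ-≈ (+-identityʳ 1#) (+-mono-≤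
        (≤-reflexive (sym (trans (*-identityʳ _) (χ-adj Ii Ij i≢j))))
        (0≤χ (does (i Fin.≟ j))))

    Σ-e : ∀ (f : Fin n → Carrier) i → ∑[ j < n ] (f j + e i j) ≈ sum f + 1#
    Σ-e f i = trans (∑-distrib-+ {n} f (e i)) (+-congˡ (sum-δ i (λ _ → 1#)))

    ≤+1⇒-1≤ : ∀ {y z} → y ≤ z + 1# → y - 1# ≤ z
    ≤+1⇒-1≤ {y} {z} y≤z+1 = 0≤⇒≤ (z + 1# - y) (≤⇒0≤ y≤z+1)
      (solve 2 (λ y z → y :- con (+ 1) :+ (z :+ con (+ 1) :- y) := z) refl y z)

    Σx-1≤A$x : ∀ i → I i ≡ true → sum x - 1# ≤ ∑[ j < n ] (adjacencyMatrix H i j * x j)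
    Σx-1≤A$x i Ii = ≤+1⇒-1≤ (≤-respʳ-≈ (Σ-e _ i) (sum-mono-≤ {n} (x≤A+e i Ii)))

    A*x≤A : ∀ i j → adjacencyMatrix H i j * x j ≤ adjacencyMatrix H i j
    A*x≤A i j with I j
    ... | true  = ≤-reflexive (*-identityʳ _)
    ... | false = ≤-respˡ-≈ (sym (zeroʳ _)) (0≤χ (does (adj? H i j)))

    Σx-1≤degree : ∀ i → I i ≡ true → sum x - 1# ≤ fromℕ (degree H i)
    Σx-1≤degree i Ii = begin
      sum x - 1#                                    ≤⟨ Σx-1≤A$x i Ii ⟩
      ∑[ j < n ] (adjacencyMatrix H i j * x j)      ≤⟨ sum-mono-≤ {n} (A*x≤A i) ⟩
      ∑[ j < n ] adjacencyMatrix H i j              ≈⟨ fromℕ-degree H i ⟨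
      fromℕ (degree H i)                            ∎

    -- The factor a + 1 splits: the share a comes from the degree of i, the share 1 from its row of
    -- the adjacency matrix.
    c≤M$x : ∀ i → I i ≡ true → c ≤ (aD+A a H $ x) i
    c≤M$x i Ii = begin
      c
        ≈⟨ solve 2 (λ a q → (a :+ con (+ 1)) :* q := a :* (q :* con (+ 1)) :+ q) refl a (sum x - 1#) ⟩
      a * ((sum x - 1#) * 1#) + (sum x - 1#)
        ≤⟨ +-mono-≤ (*-monoˡ-≤ a 0≤a (*-monoʳ-≤ 1# 0≤1 (Σx-1≤degree i Ii))) (Σx-1≤A$x i Ii) ⟩
      a * (fromℕ (degree H i) * 1#) + ∑[ j < n ] (adjacencyMatrix H i j * x j)
        ≈⟨ +-congʳ (*-congˡ (*-congˡ (reflexive (≡.cong χ Ii)))) ⟨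
      a * (fromℕ (degree H i) * x i) + ∑[ j < n ] (adjacencyMatrix H i j * x j)
        ≈⟨ aD+A-$ a H x i ⟨
      (aD+A a H $ x) i ∎

    pointwise : ∀ i → c * (x i * x i) ≤ x i * (aD+A a H $ x) i
    pointwise i = case I i Bool.≟ true of λ where
      (yes Ii) → let xi≈1 = reflexive (≡.cong χ Ii) in begin
        c * (x i * x i)               ≈⟨ *-congˡ (*-cong xi≈1 xi≈1) ⟩
        c * (1# * 1#)                 ≈⟨ solve 1 (λ c → c :* (con (+ 1) :* con (+ 1)) := con (+ 1) :* c) refl c ⟩
        1# * c                        ≤⟨ *-monoˡ-≤ 1# 0≤1 (c≤M$x i Ii) ⟩
        1# * (aD+A a H $ x) i         ≈⟨ *-congʳ xi≈1 ⟨
        x i * (aD+A a H $ x) i        ∎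
      (no ¬Ii) → let xi≈0 = reflexive (≡.cong χ (Bool.¬-not ¬Ii)) in begin
        c * (x i * x i)               ≈⟨ *-congˡ (trans (*-congʳ xi≈0) (zeroˡ (x i))) ⟩
        c * 0#                        ≈⟨ trans (zeroʳ c) (sym (zeroˡ _)) ⟩
        0# * (aD+A a H $ x) i         ≈⟨ *-congʳ xi≈0 ⟨
        x i * (aD+A a H $ x) i        ∎

    c-bound : c * x ∙ x ≤ x ∙ (aD+A a H $ x)
    c-bound = ≤-respˡ-≈ (sym (*-distribˡ-sum {n} c (λ i → x i * x i))) (sum-mono-≤ {n} pointwise)

  -- Vertices that a light cover misses or counts twice.

  module _ {n} (G : Graph n) {A B : Fin n → Bool} (cover : IsCover (arcs G) A B) where

    -- The sets I and S of the overview, where `cover-weight` is 0 and 2 respectively.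
    uncovered saturated : Fin n → Bool
    uncovered v = not (A v ∨ B v)
    saturated v = A v ∧ B v

    private
      δ = fromℕ (minDegree G)

    Adj⇒covered : ∀ {u v} → Adj G u v → A u ≡ true ⊎ B v ≡ true
    Adj⇒covered = cover ∘ ∈-arcs⁺ G

    uncovered⇒A≡false : ∀ v → uncovered v ≡ true → A v ≡ false
    uncovered⇒A≡false v Iv with A v
    ... | false = ≡.refl

    uncovered⇒B≡false : ∀ v → uncovered v ≡ true → B v ≡ false
    uncovered⇒B≡false v Iv with A v | B v
    ... | false | false = ≡.refl

    uncovered-clique : ∀ {i j} → uncovered i ≡ true → uncovered j ≡ true → i ≢ j → Adj (complement G) i j
    uncovered-clique {i} {j} Ii Ij i≢j = i≢j , λ ij → case Adj⇒covered ij of λ where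
      (inj₁ Ai) → contradiction (≡.trans (≡.sym Ai) (uncovered⇒A≡false i Ii)) λ ()
      (inj₂ Bj) → contradiction (≡.trans (≡.sym Bj) (uncovered⇒B≡false j Ij)) λ ()

    -- Neither orientation of the edge can be covered at i, so (i , j) puts j into B and (j , i)
    -- puts j into A.
    neighbour-saturated : ∀ {i j} → uncovered i ≡ true → Adj G i j → saturated j ≡ true
    neighbour-saturated {i} {j} Ii ij with Adj⇒covered ij | Adj⇒covered (adj-sym G ij)
    ... | inj₁ Ai | _       = contradiction (≡.trans (≡.sym Ai) (uncovered⇒A≡false i Ii)) λ ()
    ... | inj₂ _  | inj₂ Bi = contradiction (≡.trans (≡.sym Bi) (uncovered⇒B≡false i Ii)) λ ()
    ... | inj₂ Bj | inj₁ Aj = ≡.cong₂ _∧_ Aj Bj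

    δ≤saturated : ∀ i → uncovered i ≡ true → δ ≤ sum (χ ∘ saturated)
    δ≤saturated i Ii = begin
      δ                                     ≤⟨ fromℕ-mono-≤ (minDegree≤degree G i) ⟩
      fromℕ (degree G i)                    ≈⟨ fromℕ-degree G i ⟩
      ∑[ j < n ] χ (does (adj? G i j))      ≤⟨ sum-mono-≤ {n} pointwise ⟩
      sum (χ ∘ saturated)                   ∎
      where
      open ≤-Reasoning
      pointwise : ∀ j → χ (does (adj? G i j)) ≤ χ (saturated j)
      pointwise j with adj? G i j
      ... | yes ij = ≤-reflexive (reflexive (≡.sym (≡.cong χ (neighbour-saturated Ii ij))))
      ... | no  _  = 0≤χ (saturated j)

    -- Inclusion-exclusion for A and B, with |A ∪ B| = n - |I|, checked vertex by vertex.
    uncovered+weight : sum (χ ∘ uncovered) + sum (cover-weight G cover) ≈ sum (χ ∘ saturated) + fromℕ n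
    uncovered+weight = begin
      sum (χ ∘ uncovered) + sum (cover-weight G cover)
        ≈⟨ ∑-distrib-+ {n} _ _ ⟨
      ∑[ v < n ] (χ (uncovered v) + (χ (A v) + χ (B v)))
        ≈⟨ sum-cong-≋ {n} (λ v → pointwise (A v) (B v)) ⟩
      ∑[ v < n ] (χ (saturated v) + 1#)
        ≈⟨ ∑-distrib-+ {n} _ _ ⟩
      sum (χ ∘ saturated) + ∑[ v < n ] 1#
        ≈⟨ +-congˡ (sum-replicate n) ⟩
      sum (χ ∘ saturated) + fromℕ n ∎
      where
      open ≈-Reasoning
      pointwise : ∀ a b → χ (not (a ∨ b)) + (χ a + χ b) ≈ χ (a ∧ b) + 1#
      pointwise true  true  = trans (+-identityˡ _) refl
      pointwise true  false = trans (+-identityˡ _) (+-comm _ _)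
      pointwise false true  = +-identityˡ _
      pointwise false false = trans (+-congˡ (+-identityˡ 0#)) (+-comm _ _)

    module _ {a k} (0≤a : 0# ≤ a) (0<k : 0# < k) (light : sum (cover-weight G cover) ≤ fromℕ n - k) where

      open ≤-Reasoning

      private
        S = sum (χ ∘ saturated)
        U = sum (χ ∘ uncovered)
        Y = sum (cover-weight G cover)

      S+k≤U : S + k ≤ U
      S+k≤U = 0≤⇒≤ (fromℕ n - k - Y) (≤⇒0≤ light) (begin-equality
        S + k + (fromℕ n - k - Y)     ≈⟨ solve 4 (λ s k n y → s :+ k :+ (n :- k :- y) := s :+ n :- y) refl S k (fromℕ n) Y ⟩
        S + fromℕ n - Y               ≈⟨ +-congʳ uncovered+weight ⟨
        U + Y - Y                     ≈⟨ solve 2 (λ u y → u :+ y :- y := u) refl U Y ⟩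
        U                             ∎)

      -- Positivity of k enters here: if I were empty, S + k ≤ U would force k ≤ 0. The vertex found
      -- bounds |S| below by δ and makes the test vector nonzero.
      ∃uncovered : ∃[ v ] uncovered v ≡ true
      ∃uncovered = decidable-stable (Fin.any? (λ v → uncovered v Bool.≟ true)) λ ∄uncovered →
        proj₂ 0<k (antisym (proj₁ 0<k) (begin
          k       ≤⟨ 0≤⇒≤ S (sum-nonNegative {n} (λ v → 0≤χ (saturated v))) (+-comm k S) ⟩
          S + k   ≤⟨ S+k≤U ⟩
          U       ≈⟨ sum-zero {n} (λ v → reflexive (≡.cong χ (Bool.¬-not (λ Iv → ∄uncovered (v , Iv))))) ⟩
          0#      ∎))

      δ+k-1≤U-1 : δ + k - 1# ≤ U - 1#
      δ+k-1≤U-1 = +-mono-≤ (≤-trans (+-mono-≤ (δ≤saturated v Iv) ≤-refl) S+k≤U) ≤-refl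
        where
        v = proj₁ ∃uncovered
        Iv = proj₂ ∃uncovered

      light-cover⇒eigenvalue : ∃[ s ] (IsEigenvalue (aD+A a (complement G)) s × (a + 1#) * (δ + k - 1#) ≤ s)
      light-cover⇒eigenvalue = proj₁ U-eigenvalue , proj₁ (proj₂ U-eigenvalue) ,
        ≤-trans (*-monoˡ-≤ (a + 1#) (+-nonNegative 0≤a 0≤1) δ+k-1≤U-1) (proj₂ (proj₂ U-eigenvalue))
        where
        U-eigenvalue = clique⇒eigenvalue 0≤a (complement G) uncovered uncovered-clique
                         (proj₁ ∃uncovered) (proj₂ ∃uncovered)

theorem1p4 :
    (ℝ : CompleteOrderedField) →
    let open CompleteOrderedField ℝ
        open RealGraphTheory ℝ
    in
    (a : Carrier) → 0# ≤ a →
    (n : ℕ) (G : Graph n) → Connected G →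
    (k : Carrier) → 0# < k → k < fromℕ n →
    let δ = fromℕ (minDegree G)
        [n-k]/2 = (fromℕ n - k) / fromℕ 2
    in
    δ ≤ [n-k]/2 →
    (λ₁ : Carrier) → IsLargestEigenvalue (aD+A a (complement G)) λ₁ →
    λ₁ < (a + 1#) * (δ + k - 1#) →
    ∃[ μ ] (IsFractionalMatchingNumber G μ × [n-k]/2 < μ)
theorem1p4 ℝ a 0≤a n G _ k 0<k _ _ λ₁ (_ , λ₁-ub) (λ₁≤c , λ₁≉c) =
  μ , fractionalMatchingNumber G pair ,
  ≰⇒≥ μ≰[n-k]/2 , λ [n-k]/2≈μ → μ≰[n-k]/2 (≤-reflexive (sym [n-k]/2≈μ))
  where
  open CompleteOrderedField ℝ
  open OrderedField ℝ
  open QuadraticForms ℝ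
  open BipartiteMatching
  open FractionalMatching ℝ
  open ComplementSpectrum ℝ
  pair : TightPair (arcs G)
  pair = könig (arcs G)
  μ = fromℕ (size (TightPair.M pair)) / fromℕ 2
  μ≰[n-k]/2 : ¬ μ ≤ (fromℕ n - k) / fromℕ 2
  μ≰[n-k]/2 μ≤[n-k]/2 =
    let s , s-eigen , c≤s = light-cover⇒eigenvalue G (TightPair.cover pair) 0≤a 0<k
          -- Division by `fromℕ 2` is by definition multiplication by `½`, which is cancelled to
          -- reach the doubled inequality of weights.
          (≤-trans (cover-weight≤size G pair) (*-cancelʳ-≤ 0≤½ ½≉0 μ≤[n-k]/2))
    in λ₁≉c (antisym λ₁≤c (≤-trans c≤s (λ₁-ub s s-eigen)))
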